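{- Let $p$ be an odd prime, $v\in\mathbb{N}$ and $z\in\mathbb{Z}\setminus\{0,-1\}$. Let $c_v,\tilde c_v$ be defined by $c_0=\tilde c_0=1$ and, for $v\ge1$, $c_v=\frac{1}{z}\sum_{j=1}^{v}e_j^{(2v-1)}c_{v-j}$ and $\tilde c_v=-\frac{1}{z+1}\sum_{j=1}^{v}e_j^{(2v-1)}\tilde c_{v-j}$. If $\gcd(p,z)=1$ then $$\sum_{k=0}^{p-1}(2k+1)^{2v}D_k(z)\equiv c_v\left(\frac{ -z}{p}\right)\pmod p,$$ and if $\gcd(p,z+1)=1$ then $$\sum_{k=0}^{p-1}(-1)^k(2k+1)^{2v}D_k(z)\equiv \tilde c_v\left(\frac{z+1}{p}\right)\pmod p.$$
   Context: $D_n(z)=\sum_{k=0}^{n}\binom{n}{k}\binom{n+k}{k}z^k$ (Delannoy polynomials). For $s\in\mathbb{N}$ and $1\le j\le\lfloor (s+1)/2\rfloor$, $e_j^{(s)}=\binom{s}{2j}2^{2j-1}+\binom{s}{2j-1}2^{2j-2}$. $\left(\frac{\cdot}{p}\right)$ is the Legendre symbol. A congruence $a/b\equiv c\pmod p$ with $p\nmid b$ means $a\equiv bc\pmod p$; the denominators of $c_v$ (resp. $\tilde c_v$) at the integer $z$ divide a power of $z$ (resp. $z+1$). -}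

module Defs where

open import Data.Bool.Base using (if_then_else_)
open import Data.Fin.Base using (Fin; zero; suc; toℕ)
open import Data.Fin.Properties using (any?)
open import Data.Integer.Base using (ℤ; +_; 0ℤ; 1ℤ; -1ℤ; ∣_∣)
import Data.Integer.Base as ℤ
import Data.Integer.Properties as ℤₚ
open import Data.Integer.Divisibility.Signed using (_∣_; _∣?_)
open import Data.Nat.Base using (ℕ; zero; suc; _+_; _*_; _∸_; _^_)
open import Data.Nat.Combinatorics using (_C_)
open import Data.Nat.Coprimality using (1-coprimeTo) renaming (sym to coprime-sym)
open import Data.Product.Base using (_×_)
open import Data.Rational.Base using (ℚ; mkℚ; 1ℚ; 1/_; ↥_; ↧_)
import Data.Rational.Base as ℚ
import Data.Rational.Properties as ℚₚ
open import Data.Vec.Base using (Vec; []; _∷_; head; lookup)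
open import Relation.Binary.PropositionalEquality
  using (_≡_; _≢_; refl; cong)
open import Relation.Nullary using (¬_)
open import Relation.Nullary.Decidable using (⌊_⌋)

open import Algebra.Properties.CommutativeMonoid.Sum ℤₚ.+-0-commutativeMonoid public
  using () renaming (sum to sumℤ)
open import Algebra.Properties.CommutativeMonoid.Sum ℚₚ.+-0-commutativeMonoid public
  using () renaming (sum to sumℚ; sum-cong-≗ to sumℚ-cong)

-- ∑ℤ[ k < n ] f k is the sum of f 0 , … , f (n - 1).
∑ℤ : (n : ℕ) → (ℕ → ℤ) → ℤ
∑ℤ n f = sumℤ {n} (λ i → f (toℕ i))

syntax ∑ℤ n (λ k → x) = ∑ℤ[ k < n ] x

D : ℕ → ℤ → ℤ
D n z = ∑ℤ[ k < suc n ] (+ ((n C k) * ((n + k) C k)) ℤ.* z ℤ.^ k)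

-- Only used for j ≥ 1, where the subtractions do not truncate.
e : (s j : ℕ) → ℕ
e s j = (s C (2 * j)) * 2 ^ (2 * j ∸ 1) + (s C (2 * j ∸ 1)) * 2 ^ (2 * j ∸ 2)

fromℤ : ℤ → ℚ
fromℤ i = mkℚ i 0 (coprime-sym (1-coprimeTo ∣ i ∣))

-- Both c and c̃ satisfy  a₀ = 1,  aᵥ = r · ∑ⱼ₌₁ᵛ e (2v - 1) j · aᵥ₋ⱼ  for some
-- r : ℚ.  To make the recursion structural, history r v is the vector
-- aᵥ , aᵥ₋₁ , … , a₀.  The index i below stands for j - 1.
history : ℚ → (v : ℕ) → Vec ℚ (suc v)
history r zero    = 1ℚ ∷ []
history r (suc v) =
  (r ℚ.* sumℚ {suc v} (λ i →
    fromℤ (+ e (2 * suc v ∸ 1) (suc (toℕ i))) ℚ.* lookup (history r v) i))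
  ∷ history r v

recSeq : ℚ → ℕ → ℚ
recSeq r v = head (history r v)

lookup-history : ∀ r v (i : Fin (suc v)) →
                 lookup (history r v) i ≡ recSeq r (v ∸ toℕ i)
lookup-history r zero    zero    = refl
lookup-history r (suc v) zero    = refl
lookup-history r (suc v) (suc i) = lookup-history r v i

-- The defining recurrence; suc v ∸ suc i is v - j for the upper index suc v.
recSeq-suc : ∀ r v → recSeq r (suc v) ≡
  r ℚ.* sumℚ {suc v} (λ i →
    fromℤ (+ e (2 * suc v ∸ 1) (suc (toℕ i))) ℚ.* recSeq r (suc v ∸ suc (toℕ i)))
recSeq-suc r v = cong (r ℚ.*_) (sumℚ-cong {suc v} (λ i →
  cong (fromℤ (+ e (2 * suc v ∸ 1) (suc (toℕ i))) ℚ.*_) (lookup-history r v i)))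

z+1≢0 : ∀ {z} → z ≢ -1ℤ → z ℤ.+ 1ℤ ≢ 0ℤ
z+1≢0 {z} z≢-1 eq = z≢-1 (ℤₚ.i-j≡0⇒i≡j z -1ℤ eq)

c : (z : ℤ) → .(z ≢ 0ℤ) → ℕ → ℚ
c z z≢0 = recSeq (1/_ (fromℤ z) {{ℤ.≢-nonZero z≢0}})

c̃ : (z : ℤ) → .(z ≢ -1ℤ) → ℕ → ℚ
c̃ z z≢-1 = recSeq (ℚ.- (1/_ (fromℤ (z ℤ.+ 1ℤ)) {{ℤ.≢-nonZero (z+1≢0 z≢-1)}}))

-- The Legendre symbol (a / p), for p an odd prime.  Squares modulo p are
-- sought among the residues 0 , … , p - 1.
legendre : ℤ → ℕ → ℤ
legendre a p =
  if ⌊ + p ∣? a ⌋ then 0ℤ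
  else if ⌊ any? {p} (λ x → + p ∣? ((+ toℕ x) ℤ.* (+ toℕ x) ℤ.- a)) ⌋ then 1ℤ
  else -1ℤ

-- Congruence of an integer m and a rational a/b (in lowest terms) modulo p:
-- p does not divide b, and a ≡ b m (mod p).
infix 4 _≋_[mod_]

_≋_[mod_] : ℤ → ℚ → ℕ → Set
m ≋ q [mod p ] = (¬ (+ p ∣ ↧ q)) × (+ p ∣ (↥ q ℤ.- ↧ q ℤ.* m))

{-# OPTIONS --safe #-}

-- Write Sᵥ(z) for the first sum.  Summing the coefficients of Dₙ over n < p leaves
-- modulo p only the term of degree m = (p - 1) / 2, so S₀ ≡ (-z)^m, which is the
-- Legendre symbol by Euler's criterion.  With x = 2k + 1 and s = 2v - 1, the
-- binomial theorem gives
--   4 ∑ⱼ eⱼ x^(2v - 2j) = (x + 1) (x + 2)^s + (x - 1) (x - 2)^s - 2 x^(s + 1);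
-- summing this against D_k(z), shifting k and using the three-term recurrence of D
-- turns the right hand side into 4 z x^(2v), up to boundary terms divisible by p.
-- Hence z Sᵥ ≡ ∑ⱼ eⱼ Sᵥ₋ⱼ, the recurrence that defines c.  The alternating sums are
-- the sums at -1 - z, because D_k(-1 - z) = (-1)^k D_k(z).
module Submission where

-- `D n z` is the Legendre polynomial of degree n at 1 + 2z. Its three-term recurrence is Bonnet's,
-- and z ↦ -1 - z changes the sign of 1 + 2z, so the reflection behind the alternating sums is the
-- parity of Legendre polynomials. The sum over n < N of the j-th coefficients, multiplied by 1 +
-- 2j, has a closed form that is divisible by p when N = p and j < p. Hence only the j with p
-- dividing 1 + 2j can survive. Exactly there the factor cannot be cancelled modulo p, so the closed
-- form and its quotient by p are kept as equalities in ℤ and reduced only afterwards. In the same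
-- way the recurrence of the moments is an identity in ℤ for every upper limit N, with a boundary
-- term that is a multiple of N. The other obstacle is that the sequence c is rational while the
-- congruence is stated in lowest terms, which sums and products do not preserve. The induction
-- therefore carries arbitrary fractions with denominator prime to p, and lowest terms enter once,
-- at the end.

module DelannoyMoments where

  open import Defs
  open import Algebra.Bundles using (CommutativeMonoid)
  open import Data.Empty using (⊥-elim)
  open import Data.Fin.Base as Fin using (Fin; toℕ; fromℕ<)
  open import Data.Fin.Properties using (toℕ<n; toℕ-fromℕ<; any?)
  open import Data.Integer.Base hiding (suc)
  open import Data.Integer.Properties
  open import Data.Integer.DivMod using (_%ℕ_; _/ℕ_; a≡a%ℕn+[a/ℕn]*n)
  open import Data.Integer.Divisibility.Signed hiding (quotient)
  open import Data.Integer.GCD using (gcd; gcd-greatest)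
  open import Data.Integer.Tactic.RingSolver using (solve-∀)
  open import Data.Nat.Base as ℕ using (ℕ; zero; suc; s≤s; z≤n; _∸_)
  open import Data.Nat.Combinatorics
    using (_C_; nCn≡1; nC1≡n; k>n⇒nCk≡0; nCk+nC[k+1]≡[n+1]C[k+1])
  import Data.Nat.Coprimality as Coprimality
  import Data.Nat.Divisibility as ℕ
  open import Data.Nat.Primality using (Prime; euclidsLemma; prime⇒nonTrivial; prime⇒nonZero)
  import Data.Nat.Properties as ℕ
  open import Data.Product.Base using (∃-syntax; _×_; _,_; proj₁; proj₂)
  open import Data.Rational.Base as ℚ using (ℚ; 0ℚ; 1ℚ; ↥_; ↧_; toℚᵘ; mkℚ)
  import Data.Rational.Properties as ℚ
  open import Data.Rational.Unnormalised.Base using (*≡*)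
  import Data.Rational.Unnormalised.Properties as ℚᵘ
  open import Data.Sum.Base as Sum using (_⊎_; inj₁; inj₂; [_,_]′)
  open import Data.Vec.Base using (Vec; []; _∷_; lookup; replicate)
  open import Function.Base using (_∘_; id)
  open import Level using (0ℓ)
  open import Relation.Binary.Bundles using (Setoid)
  open import Relation.Binary.PropositionalEquality
  import Relation.Binary.Reasoning.Setoid as SetoidReasoning
  open import Relation.Nullary using (¬_; yes; no; contradiction)
  open import Algebra.Properties.Semiring.Sum +-*-semiring
    using (sum-cong-≗; ∑-distrib-+; ∑-comm; *-distribˡ-sum)
  import Algebra.Properties.Semiring.Exp +-*-semiring as Exp
  import Algebra.Properties.Semiring.Mult +-*-semiring as Mult
  import Algebra.Properties.CommutativeSemiring.Binomial +-*-commutativeSemiring as Binomial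
  import Algebra.Properties.CommutativeSemigroup
    (CommutativeMonoid.commutativeSemigroup ℚ.*-1-commutativeMonoid) as ℚ*

  -- Finite sums

  ∑-cong< : ∀ n {f g : ℕ → ℤ} → (∀ k → k ℕ.< n → f k ≡ g k) → ∑ℤ n f ≡ ∑ℤ n g
  ∑-cong< n f≗g = sum-cong-≗ {n} (λ i → f≗g (toℕ i) (toℕ<n i))

  ∑-cong : ∀ n {f g : ℕ → ℤ} → (∀ k → f k ≡ g k) → ∑ℤ n f ≡ ∑ℤ n g
  ∑-cong n f≗g = ∑-cong< n (λ k _ → f≗g k)

  ∑-last : ∀ n (f : ℕ → ℤ) → ∑ℤ (suc n) f ≡ ∑ℤ n f + f n
  ∑-last zero    f = +-comm (f 0) 0ℤ
  ∑-last (suc n) f = trans (cong (_+_ (f 0)) (∑-last n (f ∘ suc))) (sym (+-assoc (f 0) _ _))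

  ∑-+ : ∀ n (f g : ℕ → ℤ) → ∑ℤ[ k < n ] (f k + g k) ≡ ∑ℤ n f + ∑ℤ n g
  ∑-+ n f g = ∑-distrib-+ {n} (f ∘ toℕ) (g ∘ toℕ)

  ∑-*ˡ : ∀ n a (f : ℕ → ℤ) → ∑ℤ[ k < n ] (a * f k) ≡ a * ∑ℤ n f
  ∑-*ˡ n a f = sym (*-distribˡ-sum {n} a (f ∘ toℕ))

  ∑-*ʳ : ∀ n a (f : ℕ → ℤ) → ∑ℤ[ k < n ] (f k * a) ≡ ∑ℤ n f * a
  ∑-*ʳ n a f = trans (∑-cong n (λ k → *-comm (f k) a)) (trans (∑-*ˡ n a f) (*-comm a _))

  ∑-swap : ∀ m n (f : ℕ → ℕ → ℤ) →
           ∑ℤ[ i < m ] (∑ℤ[ j < n ] f i j) ≡ ∑ℤ[ j < n ] (∑ℤ[ i < m ] f i j)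
  ∑-swap m n f = ∑-comm {m} {n} (λ i j → f (toℕ i) (toℕ j))

  ∑-pairs : ∀ v (f : ℕ → ℤ) →
            ∑ℤ (v ℕ.+ v) f ≡ ∑ℤ[ i < v ] (f (i ℕ.+ i) + f (suc (i ℕ.+ i)))
  ∑-pairs zero    f = refl
  ∑-pairs (suc v) f = trans (cong (λ n → ∑ℤ (suc n) f) (ℕ.+-suc v v))
    (trans (trans (cong (λ x → f 0 + (f 1 + x)) (∑-pairs v (f ∘ suc ∘ suc))) (sym (+-assoc (f 0) (f 1) _)))
     (cong (_+_ (f 0 + f 1)) (∑-cong v λ i → cong (λ n → f (suc n) + f (suc (suc n))) (sym (ℕ.+-suc i i)))))

  -- Binomial coefficients

  -- Opaque so that unification does not unfold the computation of n C k.
  opaque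
    infixl 9 _ℂ_
    _ℂ_ : ℕ → ℕ → ℤ
    n ℂ k = + (n C k)

    ℂ≡C : ∀ n k → n ℂ k ≡ + (n C k)
    ℂ≡C n k = refl

    nℂ0≡1 : ∀ n → n ℂ 0 ≡ 1ℤ
    nℂ0≡1 n = refl

    nℂn≡1 : ∀ n → n ℂ n ≡ 1ℤ
    nℂn≡1 n = cong (+_) (nCn≡1 n)

    nℂ1≡n : ∀ n → n ℂ 1 ≡ + n
    nℂ1≡n n = cong (+_) (nC1≡n n)

    k>n⇒nℂk≡0 : ∀ {n k} → k ℕ.> n → n ℂ k ≡ 0ℤ
    k>n⇒nℂk≡0 k>n = cong (+_) (k>n⇒nCk≡0 k>n)

    pascal : ∀ n k → suc n ℂ suc k ≡ n ℂ k + n ℂ suc k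
    pascal n k = trans (cong (+_) (sym (nCk+nC[k+1]≡[n+1]C[k+1] n k))) (pos-+ (n C k) _)

  pos-^ : ∀ m n → + (m ℕ.^ n) ≡ (+ m) ^ n
  pos-^ m zero    = refl
  pos-^ m (suc n) = trans (pos-* m (m ℕ.^ n)) (cong (+ m *_) (pos-^ m n))

  binomial-theorem : ∀ n x y → (x + y) ^ n ≡ ∑ℤ[ k < suc n ] (n ℂ k * (x ^ k * y ^ (n ∸ k)))
  binomial-theorem n x y = begin
    (x + y) ^ n                                        ≡⟨ ^≡Exp (x + y) n ⟩
    (x + y) Exp.^ n                                    ≡⟨ Binomial.theorem n x y ⟩
    Binomial.binomialExpansion x y n
      ≡⟨ ∑-cong (suc n) (λ k → trans (×≡* (n C k) (x Exp.^ k * y Exp.^ (n ∸ k)))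
           (cong (_* (x Exp.^ k * y Exp.^ (n ∸ k))) (sym (ℂ≡C n k)))) ⟩
    ∑ℤ[ k < suc n ] (n ℂ k * (x Exp.^ k * y Exp.^ (n ∸ k)))
      ≡⟨ ∑-cong (suc n) (λ k → cong (n ℂ k *_) (sym (cong₂ _*_ (^≡Exp x k) (^≡Exp y (n ∸ k))))) ⟩
    ∑ℤ[ k < suc n ] (n ℂ k * (x ^ k * y ^ (n ∸ k)))  ∎
    where
    open ≡-Reasoning
    ^≡Exp : ∀ x n → x ^ n ≡ x Exp.^ n
    ^≡Exp x zero    = refl
    ^≡Exp x (suc n) = cong (x *_) (^≡Exp x n)
    ×≡* : ∀ n x → n Mult.× x ≡ + n * x
    ×≡* zero    x = refl
    ×≡* (suc n) x = trans (cong (_+_ x) (×≡* n x)) (sym (suc-* (+ n) x))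

  absorption : ∀ n k → + suc k * suc n ℂ suc k ≡ + suc n * n ℂ k
  absorption n       zero    = trans (*-identityˡ _) (trans (nℂ1≡n (suc n))
    (sym (trans (cong (+ suc n *_) (nℂ0≡1 n)) (*-identityʳ _))))
  absorption zero    (suc k) = begin
    + suc (suc k) * 1 ℂ suc (suc k)  ≡⟨ cong (+ suc (suc k) *_) (k>n⇒nℂk≡0 (s≤s (s≤s z≤n))) ⟩
    + suc (suc k) * 0ℤ               ≡⟨ *-zeroʳ (+ suc (suc k)) ⟩
    1ℤ * 0ℤ                          ≡⟨ cong (1ℤ *_) (k>n⇒nℂk≡0 (s≤s z≤n)) ⟨
    1ℤ * 0 ℂ suc k                   ∎
    where open ≡-Reasoning
  absorption (suc n) (suc k) = begin
    (1ℤ + + suc k) * suc (suc n) ℂ suc (suc k)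
      ≡⟨ cong ((1ℤ + + suc k) *_) (pascal (suc n) (suc k)) ⟩
    (1ℤ + + suc k) * (suc n ℂ suc k + suc n ℂ suc (suc k))
      ≡⟨ distribute (+ suc k) (suc n ℂ suc k) (suc n ℂ suc (suc k)) ⟩
    suc n ℂ suc k + (+ suc k * suc n ℂ suc k + (1ℤ + + suc k) * suc n ℂ suc (suc k))
      ≡⟨ cong (_+_ (suc n ℂ suc k)) (cong₂ _+_ (absorption n k) (absorption n (suc k))) ⟩
    suc n ℂ suc k + (+ suc n * n ℂ k + + suc n * n ℂ suc k)
      ≡⟨ cong (_+_ (suc n ℂ suc k)) (trans (sym (*-distribˡ-+ (+ suc n) (n ℂ k) _)) (cong (+ suc n *_) (sym (pascal n k)))) ⟩
    suc n ℂ suc k + + suc n * suc n ℂ suc k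
      ≡⟨ suc-* (+ suc n) _ ⟨
    + suc (suc n) * suc n ℂ suc k ∎
    where
    open ≡-Reasoning
    distribute : ∀ a c d → (1ℤ + a) * (c + d) ≡ c + (a * c + (1ℤ + a) * d)
    distribute = solve-∀

  absorption-sucʳ : ∀ n k → + suc k * n ℂ suc k ≡ (+ n - + k) * n ℂ k
  absorption-sucʳ n k = solve (+ n) (+ k) (n ℂ k) (n ℂ suc k)
     (trans (cong (+ suc k *_) (sym (pascal n k))) (absorption n k))
    where
    open ≡-Reasoning
    solve : ∀ n k c d → (1ℤ + k) * (c + d) ≡ (1ℤ + n) * c → (1ℤ + k) * d ≡ (n - k) * c
    solve n k c d eq = begin
      (1ℤ + k) * d                         ≡⟨ l k c d ⟩
      (1ℤ + k) * (c + d) - (1ℤ + k) * c    ≡⟨ cong (_- (1ℤ + k) * c) eq ⟩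
      (1ℤ + n) * c - (1ℤ + k) * c          ≡⟨ r n k c ⟩
      (n - k) * c                          ∎
      where
      l : ∀ k c d → (1ℤ + k) * d ≡ (1ℤ + k) * (c + d) - (1ℤ + k) * c
      l = solve-∀
      r : ∀ n k c → (1ℤ + n) * c - (1ℤ + k) * c ≡ (n - k) * c
      r = solve-∀

  -- Both sides equal (k + 1) C(n + 1, k + 1).
  absorption-sucˡ : ∀ n k → (1ℤ + + n - + k) * suc n ℂ k ≡ + suc n * n ℂ k
  absorption-sucˡ n k = trans (sym (absorption-sucʳ (suc n) k)) (absorption n k)

  -- Congruences modulo a prime

  module Congruence (n : ℤ) where

    infix 4 _≈_
    record _≈_ (a b : ℤ) : Set where
      constructor mod
      field divisible : n ∣ a - b
    open _≈_ public

    ∣-subst : ∀ {a b} → a ≡ b → n ∣ a → n ∣ b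
    ∣-subst = subst (n ∣_)

    ≡⇒≈ : ∀ {a b} → a ≡ b → a ≈ b
    ≡⇒≈ {a} refl = mod (∣-subst (sym (+-inverseʳ a)) (divides 0ℤ refl))

    ≈-sym : ∀ {a b} → a ≈ b → b ≈ a
    ≈-sym {a} {b} (mod d) = mod (∣-subst (eq a b) (∣m⇒∣-m d))
      where
      eq : ∀ a b → - (a - b) ≡ b - a
      eq = solve-∀

    ≈-trans : ∀ {a b c} → a ≈ b → b ≈ c → a ≈ c
    ≈-trans {a} {b} {c} (mod d) (mod d′) = mod (∣-subst (eq a b c) (∣m∣n⇒∣m+n d d′))
      where
      eq : ∀ a b c → (a - b) + (b - c) ≡ a - c
      eq = solve-∀

    ≈-setoid : Setoid 0ℓ 0ℓ
    ≈-setoid = record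
      { _≈_ = _≈_ ; isEquivalence = record { refl = ≡⇒≈ refl ; sym = ≈-sym ; trans = ≈-trans } }

    +-cong : ∀ {a b c d} → a ≈ b → c ≈ d → a + c ≈ b + d
    +-cong {a} {b} {c} {d} (mod u) (mod v) = mod (∣-subst (eq a b c d) (∣m∣n⇒∣m+n u v))
      where
      eq : ∀ a b c d → (a - b) + (c - d) ≡ (a + c) - (b + d)
      eq = solve-∀

    *-cong : ∀ {a b c d} → a ≈ b → c ≈ d → a * c ≈ b * d
    *-cong {a} {b} {c} {d} (mod u) (mod v) =
      mod (∣-subst (eq a b c d) (∣m∣n⇒∣m+n (∣m⇒∣m*n c u) (∣n⇒∣m*n b v)))
      where
      eq : ∀ a b c d → (a - b) * c + b * (c - d) ≡ a * c - b * d
      eq = solve-∀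

    *-congˡ : ∀ a {b c} → b ≈ c → a * b ≈ a * c
    *-congˡ a = *-cong (≡⇒≈ {a} refl)

    +-congˡ : ∀ a {b c} → b ≈ c → a + b ≈ a + c
    +-congˡ a = +-cong (≡⇒≈ {a} refl)

    ^-congˡ : ∀ k {a b} → a ≈ b → a ^ k ≈ b ^ k
    ^-congˡ zero    a≈b = ≡⇒≈ refl
    ^-congˡ (suc k) a≈b = *-cong a≈b (^-congˡ k a≈b)

    ∣⇒≈0 : ∀ {a} → n ∣ a → a ≈ 0ℤ
    ∣⇒≈0 {a} d = mod (∣-subst (sym (+-identityʳ a)) d)

    ≈0⇒∣ : ∀ {a} → a ≈ 0ℤ → n ∣ a
    ≈0⇒∣ {a} (mod d) = ∣-subst (+-identityʳ a) d

    ∑≈0 : ∀ k {f : ℕ → ℤ} → (∀ i → i ℕ.< k → f i ≈ 0ℤ) → ∑ℤ k f ≈ 0ℤ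
    ∑≈0 zero    f≈0 = ≡⇒≈ refl
    ∑≈0 (suc k) f≈0 = +-cong (f≈0 0 (s≤s z≤n)) (∑≈0 k (λ i i<k → f≈0 (suc i) (s≤s i<k)))

    ∑-single≈ : ∀ k {j} {f : ℕ → ℤ} → j ℕ.< k →
                (∀ i → i ℕ.< k → i ≢ j → f i ≈ 0ℤ) → ∑ℤ k f ≈ f j
    ∑-single≈ (suc k) {zero} {f} _ f≈0 = ≈-trans
      (+-congˡ (f 0) (∑≈0 k (λ i i<k → f≈0 (suc i) (s≤s i<k) λ ())))
      (≡⇒≈ (+-identityʳ (f 0)))
    ∑-single≈ (suc k) {suc j} {f} (s≤s j<k) f≈0 = ≈-trans
      (+-cong (f≈0 0 (s≤s z≤n) λ ())
              (∑-single≈ k j<k (λ i i<k i≢j → f≈0 (suc i) (s≤s i<k) (i≢j ∘ ℕ.suc-injective))))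
      (≡⇒≈ (+-identityˡ (f (suc j))))

  -- A vector of length d holds the coefficients, constant term first, of a monic
  -- polynomial of degree d; the leading 1 is implicit.
  evalMonic : ∀ {d} → Vec ℤ d → ℤ → ℤ
  evalMonic []       x = 1ℤ
  evalMonic (c ∷ cs) x = c + x * evalMonic cs x

  -- Synthetic division by X - r: the coefficients are the intermediate values of Horner's scheme at
  -- r, and the final value is the remainder.
  quotient : ∀ {d} → ℤ → Vec ℤ (suc d) → Vec ℤ d
  quotient r (c ∷ [])      = []
  quotient r (c ∷ c′ ∷ cs) = evalMonic (c′ ∷ cs) r ∷ quotient r (c′ ∷ cs)

  evalMonic-quotient : ∀ {d} r x (cs : Vec ℤ (suc d)) →
    evalMonic cs x ≡ evalMonic cs r + (x - r) * evalMonic (quotient r cs) x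
  evalMonic-quotient r x (c ∷ []) = eq c x r
    where
    eq : ∀ c x r → c + x * 1ℤ ≡ c + r * 1ℤ + (x - r) * 1ℤ
    eq = solve-∀
  evalMonic-quotient r x (c ∷ c′ ∷ cs) = trans
    (cong (λ t → c + x * t) (evalMonic-quotient r x (c′ ∷ cs)))
    (eq c x r (evalMonic (c′ ∷ cs) r) (evalMonic (quotient r (c′ ∷ cs)) x))
    where
    eq : ∀ c x r u q → c + x * (u + (x - r) * q) ≡ c + r * u + (x - r) * (u + x * q)
    eq = solve-∀

  evalMonic-replicate-0 : ∀ d x → evalMonic (replicate d 0ℤ) x ≡ x ^ d
  evalMonic-replicate-0 zero    x = refl
  evalMonic-replicate-0 (suc d) x = trans (+-identityˡ _) (cong (x *_) (evalMonic-replicate-0 d x))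

  -- Roots of polynomials modulo p, Fermat's little theorem and Euler's criterion

  module PrimeModulus (p : ℕ) (p-prime : Prime p) where

    open Congruence (+ p) public
    open SetoidReasoning ≈-setoid

    euclid : ∀ a b → + p ∣ a * b → (+ p ∣ a) ⊎ (+ p ∣ b)
    euclid a b d = Sum.map ∣ᵤ⇒∣ ∣ᵤ⇒∣
      (euclidsLemma ∣ a ∣ ∣ b ∣ p-prime (subst (p ℕ.∣_) (abs-* a b) (∣⇒∣ᵤ d)))

    p∤small : ∀ {k} → 0 ℕ.< k → k ℕ.< p → ¬ (+ p ∣ + k)
    p∤small {suc k} _ k<p d = ℕ.<⇒≱ k<p (ℕ.∣⇒≤ (∣⇒∣ᵤ d))

    1<p : 1 ℕ.< p
    1<p = ℕ.nonTrivial⇒n>1 p {{prime⇒nonTrivial p-prime}}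

    *-cancelˡ : ∀ a {b c} → ¬ (+ p ∣ a) → a * b ≈ a * c → b ≈ c
    *-cancelˡ a {b} {c} p∤a (mod d) =
      [ ⊥-elim ∘ p∤a , mod ]′ (euclid a (b - c) (∣-subst (eq a b c) d))
      where
      eq : ∀ a b c → a * b - a * c ≡ a * (b - c)
      eq = solve-∀

    gcd≡1⇒p∤ : ∀ {z} → gcd (+ p) z ≡ 1ℤ → ¬ (+ p ∣ z)
    gcd≡1⇒p∤ {z} gcd≡1 p∣z = p∤small {1} (s≤s z≤n) 1<p
      (∣ᵤ⇒∣ (subst (λ g → p ℕ.∣ ∣ g ∣) gcd≡1 (gcd-greatest {+ p} {z} {+ p} ℕ.∣-refl (∣⇒∣ᵤ p∣z))))

    -- Lagrange's bound. Division by the last root leaves a polynomial that vanishes at the other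
    -- points, because p is prime and does not divide their differences from that root. The quotient
    -- stays monic, so the descent ends at the constant 1, which p does not divide.
    monic-roots : ∀ {d} (cs : Vec ℤ d) (r : ℕ → ℤ) →
      (∀ i j → i ℕ.< j → j ℕ.≤ d → ¬ (r i ≈ r j)) →
      ¬ (∀ i → i ℕ.≤ d → evalMonic cs (r i) ≈ 0ℤ)
    monic-roots []       r distinct root = p∤small (s≤s z≤n) 1<p (≈0⇒∣ (root 0 z≤n))
    monic-roots {suc d} cs r distinct root = monic-roots (quotient rd cs) r
      (λ i j i<j j≤d → distinct i j i<j (ℕ.m≤n⇒m≤1+n j≤d)) root′
      where
      rd = r (suc d)
      root′ : ∀ i → i ℕ.≤ d → evalMonic (quotient rd cs) (r i) ≈ 0ℤ
      root′ i i≤d = [ (λ d∣ → ⊥-elim (distinct i (suc d) (s≤s i≤d) ℕ.≤-refl (mod d∣))) , ∣⇒≈0 ]′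
        (euclid (r i - rd) _ (≈0⇒∣ (begin
          (r i - rd) * q                         ≡⟨ +-identityˡ _ ⟨
          0ℤ + (r i - rd) * q                    ≈⟨ +-cong (≈-sym (root (suc d) ℕ.≤-refl)) (≡⇒≈ refl) ⟩
          evalMonic cs rd + (r i - rd) * q       ≡⟨ evalMonic-quotient rd (r i) cs ⟨
          evalMonic cs (r i)                     ≈⟨ root i (ℕ.m≤n⇒m≤1+n i≤d) ⟩
          0ℤ                                     ∎)))
        where q = evalMonic (quotient rd cs) (r i)

    -- By `absorption`, p divides (i + 1) C(p, i + 1), and i + 1 is too small to contain the factor
    -- p.
    p∣pℂk : ∀ {q} → p ≡ suc q → ∀ i → i ℕ.< q → p ℂ suc i ≈ 0ℤ
    p∣pℂk {q} refl i i<q = [ ⊥-elim ∘ p∤small (s≤s z≤n) (s≤s i<q) , ∣⇒≈0 ]′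
      (euclid (+ suc i) (p ℂ suc i) (∣-subst (sym (absorption q i)) (∣m⇒∣m*n (q ℂ i) ∣-refl)))

    fermat-ℕ : ∀ {q} → p ≡ suc q → ∀ k → (+ k) ^ p ≈ + k
    fermat-ℕ {q} refl zero    = ≡⇒≈ refl
    fermat-ℕ {q} refl (suc k) = begin
      (+ suc k) ^ p                       ≡⟨ cong (_^ p) (+-comm 1ℤ (+ k)) ⟩
      (+ k + 1ℤ) ^ p                      ≡⟨ binomial-theorem p (+ k) 1ℤ ⟩
      ∑ℤ (suc p) f                        ≡⟨ cong (_+_ (f 0)) (∑-last q (f ∘ suc)) ⟩
      f 0 + (∑ℤ q (f ∘ suc) + f p)        ≈⟨ +-cong (≡⇒≈ f0≡1) (+-cong (∑≈0 q middle) (≡⇒≈ fp≡k^p)) ⟩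
      1ℤ + (0ℤ + (+ k) ^ p)               ≡⟨ cong (_+_ 1ℤ) (+-identityˡ ((+ k) ^ p)) ⟩
      1ℤ + (+ k) ^ p                      ≈⟨ +-congˡ 1ℤ (fermat-ℕ refl k) ⟩
      + suc k                             ∎
      where
      f : ℕ → ℤ
      f i = p ℂ i * ((+ k) ^ i * 1ℤ ^ (p ∸ i))
      f0≡1 : f 0 ≡ 1ℤ
      f0≡1 = cong₂ (λ u w → u * (1ℤ * w)) (nℂ0≡1 p) (^-zeroˡ p)
      fp≡k^p : f p ≡ (+ k) ^ p
      fp≡k^p = trans (cong₂ _*_ (nℂn≡1 p) (trans (cong ((+ k) ^ p *_) (^-zeroˡ (p ∸ p))) (*-identityʳ _))) (*-identityˡ _)
      middle : ∀ i → i ℕ.< q → f (suc i) ≈ 0ℤ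
      middle i i<q = *-cong (p∣pℂk refl i i<q) (≡⇒≈ refl)

    fermat : ∀ a → a ^ p ≈ a
    fermat a = begin
      a ^ p         ≈⟨ ^-congˡ p a≈r ⟩
      (+ r) ^ p     ≈⟨ fermat-ℕ (sym (ℕ.suc-pred p)) r ⟩
      + r           ≈⟨ a≈r ⟨
      a             ∎
      where
      instance _ = prime⇒nonZero p-prime
      r = a %ℕ p
      eq : ∀ u v → u + v - u ≡ v
      eq = solve-∀
      a≈r : a ≈ + r
      a≈r = mod (divides (a /ℕ p) (trans (cong (_- + r) (a≡a%ℕn+[a/ℕn]*n a p)) (eq (+ r) _)))

    module _ {m : ℕ} (p≡1+m+m : p ≡ suc (m ℕ.+ m)) where

      x^[p-1]≈1 : ∀ {x} → ¬ (+ p ∣ x) → x ^ (m ℕ.+ m) ≈ 1ℤ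
      x^[p-1]≈1 {x} p∤x = *-cancelˡ x p∤x (begin
        x ^ suc (m ℕ.+ m)   ≡⟨ cong (x ^_) p≡1+m+m ⟨
        x ^ p               ≈⟨ fermat x ⟩
        x                   ≡⟨ *-identityʳ x ⟨
        x * 1ℤ              ∎)

      square^m≈1 : ∀ {x} → ¬ (+ p ∣ x) → (x * x) ^ m ≈ 1ℤ
      square^m≈1 {x} p∤x = ≈-trans (≡⇒≈ eq) (x^[p-1]≈1 p∤x)
        where
        eq : (x * x) ^ m ≡ x ^ (m ℕ.+ m)
        eq = trans (cong (_^ m) (cong (x *_) (sym (*-identityʳ x))))
           (trans (^-*-assoc x 2 m) (cong (λ t → x ^ (m ℕ.+ t)) (ℕ.+-identityʳ m)))

      -- Otherwise a , 1² , … , m² would be m + 1 distinct roots of x ^ m - 1.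
      nonSquare^m≉1 : ∀ {a} → (∀ x → x ℕ.< p → ¬ (+ x * + x ≈ a)) → ¬ (a ^ m ≈ 1ℤ)
      nonSquare^m≉1 {a} nonSquare a^m≈1 = go m refl
        where
        go : ∀ m′ → ¬ (m ≡ m′)
        -- The constant coefficient -1 of X^m - 1 is stored apart from the implicit leading 1, so m
        -- must be a successor; m = 0 would force p = 1.
        go zero     refl = ℕ.<⇒≢ 1<p (sym p≡1+m+m)
        go (suc m′) refl = monic-roots (-1ℤ ∷ replicate m′ 0ℤ) r distinct root
          where
          r : ℕ → ℤ
          r zero    = a
          r (suc i) = + suc i * + suc i
          ≤m⇒<p : ∀ {j} → j ℕ.≤ m → j ℕ.< p
          ≤m⇒<p j≤m = subst (_ ℕ.<_) (sym p≡1+m+m) (s≤s (ℕ.≤-trans j≤m (ℕ.m≤m+n m m)))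
          distinct : ∀ i j → i ℕ.< j → j ℕ.≤ m → ¬ (r i ≈ r j)
          distinct zero    (suc j) _   j≤m ri≈rj = nonSquare (suc j) (≤m⇒<p j≤m) (≈-sym ri≈rj)
          -- A difference of two squares factors into a difference and a sum of roots; both are
          -- positive and at most 2m = p - 1.
          distinct (suc i) (suc j) i<j j≤m ri≈rj =
            [ p∤small (ℕ.m<n⇒0<n∸m i<j) (ℕ.≤-<-trans (ℕ.m∸n≤m (suc j) (suc i)) (≤m⇒<p j≤m)) ∘ ∣-subst j-i
            , p∤small (s≤s z≤n) (subst (suc j ℕ.+ suc i ℕ.<_) (sym p≡1+m+m)
                (s≤s (ℕ.+-mono-≤ j≤m (ℕ.<⇒≤ (ℕ.<-≤-trans i<j j≤m)))))
            ]′ (euclid (+ suc j - + suc i) (+ suc j + + suc i)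
                  (∣-subst (factor (+ suc j) (+ suc i)) (divisible (≈-sym ri≈rj))))
            where
            factor : ∀ x y → x * x - y * y ≡ (x - y) * (x + y)
            factor = solve-∀
            j-i : + suc j - + suc i ≡ + (suc j ∸ suc i)
            j-i = trans (m-n≡m⊖n (suc j) (suc i)) (⊖-≥ (ℕ.<⇒≤ i<j))
          root : ∀ i → i ℕ.≤ m → evalMonic (-1ℤ ∷ replicate m′ 0ℤ) (r i) ≈ 0ℤ
          root i i≤m = begin
            -1ℤ + r i * evalMonic (replicate m′ 0ℤ) (r i) ≡⟨ cong (λ t → -1ℤ + r i * t) (evalMonic-replicate-0 m′ (r i)) ⟩
            -1ℤ + r i ^ m                                 ≈⟨ +-congˡ -1ℤ (ri^m≈1 i i≤m) ⟩
            0ℤ                                            ∎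
            where
            ri^m≈1 : ∀ i → i ℕ.≤ m → r i ^ m ≈ 1ℤ
            ri^m≈1 zero    _   = a^m≈1
            ri^m≈1 (suc i) i≤m = square^m≈1 (p∤small (s≤s z≤n) (≤m⇒<p i≤m))

      -- By Fermat p divides (a^m - 1)(a^m + 1), and for a non-square the first factor is excluded.
      -- The case split repeats the tests in `legendre`, so that the right side computes.
      euler-criterion : ∀ {a} → ¬ (+ p ∣ a) → a ^ m ≈ legendre a p
      euler-criterion {a} p∤a with + p ∣? a
      ... | yes p∣a = contradiction p∣a p∤a
      ... | no  _   with any? {p} (λ x → + p ∣? ((+ toℕ x) * (+ toℕ x) - a))
      ...   | yes (x , x²≈a) = begin
        a ^ m                   ≈⟨ ^-congˡ m (mod x²≈a) ⟨
        (+ toℕ x * + toℕ x) ^ m ≈⟨ square^m≈1 {+ toℕ x} (λ p∣x → p∤a (≈0⇒∣ (≈-trans (≈-sym (mod x²≈a)) (∣⇒≈0 (∣m⇒∣m*n (+ toℕ x) p∣x))))) ⟩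
        1ℤ                      ∎
      ...   | no ∄x = [ (λ d → ⊥-elim (nonSquare^m≉1 nonSquare (mod d))) , mod ]′
        (euclid (a ^ m - 1ℤ) (a ^ m - -1ℤ) (∣-subst (eq (a ^ m))
          (divisible (≈-trans (≡⇒≈ (sym (^-distribˡ-+-* a m m))) (x^[p-1]≈1 p∤a)))))
        where
        eq : ∀ u → u * u - 1ℤ ≡ (u - 1ℤ) * (u - -1ℤ)
        eq = solve-∀
        nonSquare : ∀ x → x ℕ.< p → ¬ (+ x * + x ≈ a)
        nonSquare x x<p (mod d) = ∄x (fromℕ< x<p , subst (λ t → + p ∣ + t * + t - a) (sym (toℕ-fromℕ< x<p)) d)

  -- Delannoy polynomials

  opaque
    delannoy : ℕ → ℕ → ℤ
    delannoy n k = n ℂ k * (n ℕ.+ k) ℂ k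

    delannoy≡C*C : ∀ n k → delannoy n k ≡ + ((n C k) ℕ.* ((n ℕ.+ k) C k))
    delannoy≡C*C n k = trans (cong₂ _*_ (ℂ≡C n k) (ℂ≡C (n ℕ.+ k) k)) (sym (pos-* (n C k) _))

    delannoy-0 : ∀ n → delannoy n 0 ≡ 1ℤ
    delannoy-0 n = cong₂ _*_ (nℂ0≡1 n) (nℂ0≡1 (n ℕ.+ 0))

    k>n⇒delannoy≡0 : ∀ {n k} → k ℕ.> n → delannoy n k ≡ 0ℤ
    k>n⇒delannoy≡0 {n} {k} k>n = cong (_* (n ℕ.+ k) ℂ k) (k>n⇒nℂk≡0 k>n)

    -- The factor n + 1 released by the first binomial is what the second needs to become (n + k +
    -- 1) C(n + k, k). This and `delannoy-sucʳ` are the two hypergeometric ratios from which the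
    -- later identities for the coefficients are derived.
    delannoy-sucˡ : ∀ n k → (1ℤ + + n - + k) * delannoy (suc n) k ≡ (1ℤ + + n + + k) * delannoy n k
    delannoy-sucˡ n k = begin
      (1ℤ + + n - + k) * (suc n ℂ k * (suc n ℕ.+ k) ℂ k)
        ≡⟨ *-assoc (1ℤ + + n - + k) (suc n ℂ k) _ ⟨
      (1ℤ + + n - + k) * suc n ℂ k * (suc n ℕ.+ k) ℂ k
        ≡⟨ cong (_* (suc n ℕ.+ k) ℂ k) (absorption-sucˡ n k) ⟩
      + suc n * n ℂ k * (suc n ℕ.+ k) ℂ k
        ≡⟨ exchange (+ suc n) (n ℂ k) _ ⟩
      n ℂ k * (+ suc n * (suc n ℕ.+ k) ℂ k)
        ≡⟨ cong (λ t → n ℂ k * (t * (suc n ℕ.+ k) ℂ k)) (sym (cancel (+ n) (+ k))) ⟩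
      n ℂ k * ((1ℤ + (+ n + + k) - + k) * (suc n ℕ.+ k) ℂ k)
        ≡⟨ cong (n ℂ k *_) (absorption-sucˡ (n ℕ.+ k) k) ⟩
      n ℂ k * ((1ℤ + (+ n + + k)) * (n ℕ.+ k) ℂ k)
        ≡⟨ collect (+ n) (+ k) (n ℂ k) _ ⟩
      (1ℤ + + n + + k) * (n ℂ k * (n ℕ.+ k) ℂ k) ∎
      where
      open ≡-Reasoning
      exchange : ∀ a b c → a * b * c ≡ b * (a * c)
      exchange = solve-∀
      cancel : ∀ n k → 1ℤ + (n + k) - k ≡ 1ℤ + n
      cancel = solve-∀
      collect : ∀ n k b c → b * ((1ℤ + (n + k)) * c) ≡ (1ℤ + n + k) * (b * c)
      collect = solve-∀

    delannoy-sucʳ : ∀ n k → (1ℤ + + k) * (1ℤ + + k) * delannoy n (suc k) ≡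
                            (+ n - + k) * (1ℤ + + n + + k) * delannoy n k
    delannoy-sucʳ n k = begin
      (1ℤ + + k) * (1ℤ + + k) * (n ℂ suc k * (n ℕ.+ suc k) ℂ suc k)
        ≡⟨ cong (λ t → (1ℤ + + k) * (1ℤ + + k) * (n ℂ suc k * t ℂ suc k)) (ℕ.+-suc n k) ⟩
      (1ℤ + + k) * (1ℤ + + k) * (n ℂ suc k * suc (n ℕ.+ k) ℂ suc k)
        ≡⟨ interchange (1ℤ + + k) (1ℤ + + k) (n ℂ suc k) _ ⟩
      (1ℤ + + k) * n ℂ suc k * ((1ℤ + + k) * suc (n ℕ.+ k) ℂ suc k)
        ≡⟨ cong₂ _*_ (absorption-sucʳ n k) (absorption (n ℕ.+ k) k) ⟩
      (+ n - + k) * n ℂ k * ((1ℤ + (+ n + + k)) * (n ℕ.+ k) ℂ k)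
        ≡⟨ collect (+ n) (+ k) (n ℂ k) _ ⟩
      (+ n - + k) * (1ℤ + + n + + k) * (n ℂ k * (n ℕ.+ k) ℂ k) ∎
      where
      open ≡-Reasoning
      interchange : ∀ a b c d → a * b * (c * d) ≡ a * c * (b * d)
      interchange = solve-∀
      collect : ∀ n k b c → (n - k) * b * ((1ℤ + (n + k)) * c) ≡ (n - k) * (1ℤ + n + k) * (b * c)
      collect = solve-∀

  -- After multiplication by (k + 1)² everything is a multiple of delannoy (suc n) k.
  delannoy-recurrence : ∀ n k →
    (+ 2 + + n) * delannoy (suc (suc n)) (suc k) + (1ℤ + + n) * delannoy n (suc k) ≡
    (+ 3 + + 2 * + n) * (delannoy (suc n) (suc k) + + 2 * delannoy (suc n) k)
  delannoy-recurrence n k = *-cancelˡ-≡ (+ suc k) _ _ (*-cancelˡ-≡ (+ suc k) _ _ (begin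
    (1ℤ + κ) * ((1ℤ + κ) * ((+ 2 + ν) * x₂′ + (1ℤ + ν) * x₀′))
      ≡⟨ expand ν κ x₂′ x₀′ ⟩
    (+ 2 + ν) * ((1ℤ + κ) * (1ℤ + κ) * x₂′) + (1ℤ + ν) * ((1ℤ + κ) * (1ℤ + κ) * x₀′)
      ≡⟨ cong₂ (λ s t → (+ 2 + ν) * s + (1ℤ + ν) * t) (delannoy-sucʳ (suc (suc n)) k) (delannoy-sucʳ n k) ⟩
    (+ 2 + ν) * ((+ 2 + ν - κ) * (1ℤ + (+ 2 + ν) + κ) * x₂) + (1ℤ + ν) * ((ν - κ) * (1ℤ + ν + κ) * x₀)
      ≡⟨ regroup ν κ x₂ x₀ ⟩
    (+ 2 + ν) * (+ 3 + ν + κ) * ((1ℤ + (1ℤ + ν) - κ) * x₂) + (1ℤ + ν) * (ν - κ) * ((1ℤ + ν + κ) * x₀)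
      ≡⟨ cong₂ (λ s t → (+ 2 + ν) * (+ 3 + ν + κ) * s + (1ℤ + ν) * (ν - κ) * t)
           (delannoy-sucˡ (suc n) k) (sym (delannoy-sucˡ n k)) ⟩
    (+ 2 + ν) * (+ 3 + ν + κ) * ((1ℤ + (1ℤ + ν) + κ) * x₁) + (1ℤ + ν) * (ν - κ) * ((1ℤ + ν - κ) * x₁)
      ≡⟨ key ν κ x₁ ⟩
    (+ 3 + + 2 * ν) * ((1ℤ + ν - κ) * (1ℤ + (1ℤ + ν) + κ) * x₁ + (1ℤ + κ) * (1ℤ + κ) * (+ 2 * x₁))
      ≡⟨ cong (λ s → (+ 3 + + 2 * ν) * (s + (1ℤ + κ) * (1ℤ + κ) * (+ 2 * x₁))) (delannoy-sucʳ (suc n) k) ⟨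
    (+ 3 + + 2 * ν) * ((1ℤ + κ) * (1ℤ + κ) * x₁′ + (1ℤ + κ) * (1ℤ + κ) * (+ 2 * x₁))
      ≡⟨ collect ν κ x₁′ x₁ ⟩
    (1ℤ + κ) * ((1ℤ + κ) * ((+ 3 + + 2 * ν) * (x₁′ + + 2 * x₁))) ∎))
    where
    open ≡-Reasoning
    ν = + n
    κ = + k
    x₀ = delannoy n k
    x₁ = delannoy (suc n) k
    x₂ = delannoy (suc (suc n)) k
    x₀′ = delannoy n (suc k)
    x₁′ = delannoy (suc n) (suc k)
    x₂′ = delannoy (suc (suc n)) (suc k)
    expand : ∀ ν κ x y → (1ℤ + κ) * ((1ℤ + κ) * ((+ 2 + ν) * x + (1ℤ + ν) * y)) ≡
      (+ 2 + ν) * ((1ℤ + κ) * (1ℤ + κ) * x) + (1ℤ + ν) * ((1ℤ + κ) * (1ℤ + κ) * y)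
    expand = solve-∀
    regroup : ∀ ν κ x y →
      (+ 2 + ν) * ((+ 2 + ν - κ) * (1ℤ + (+ 2 + ν) + κ) * x) + (1ℤ + ν) * ((ν - κ) * (1ℤ + ν + κ) * y) ≡
      (+ 2 + ν) * (+ 3 + ν + κ) * ((1ℤ + (1ℤ + ν) - κ) * x) + (1ℤ + ν) * (ν - κ) * ((1ℤ + ν + κ) * y)
    regroup = solve-∀
    key : ∀ ν κ x →
      (+ 2 + ν) * (+ 3 + ν + κ) * ((1ℤ + (1ℤ + ν) + κ) * x) + (1ℤ + ν) * (ν - κ) * ((1ℤ + ν - κ) * x) ≡
      (+ 3 + + 2 * ν) * ((1ℤ + ν - κ) * (1ℤ + (1ℤ + ν) + κ) * x + (1ℤ + κ) * (1ℤ + κ) * (+ 2 * x))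
    key = solve-∀
    collect : ∀ ν κ x y →
      (+ 3 + + 2 * ν) * ((1ℤ + κ) * (1ℤ + κ) * x + (1ℤ + κ) * (1ℤ + κ) * (+ 2 * y)) ≡
      (1ℤ + κ) * ((1ℤ + κ) * ((+ 3 + + 2 * ν) * (x + + 2 * y)))
    collect = solve-∀

  -- Padding with zero coefficients lets polynomials of different degrees be added termwise over a
  -- common range.
  D-truncate : ∀ n z {N} → n ℕ.< N → D n z ≡ ∑ℤ[ k < N ] (delannoy n k * z ^ k)
  D-truncate n z n<N = go (ℕ.≤⇒≤′ n<N)
    where
    open ≡-Reasoning
    go : ∀ {N} → suc n ℕ.≤′ N → D n z ≡ ∑ℤ[ k < N ] (delannoy n k * z ^ k)
    go (ℕ.≤′-reflexive refl) = ∑-cong (suc n) (λ k → cong (_* z ^ k) (sym (delannoy≡C*C n k)))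
    go (ℕ.≤′-step {N} 1+n≤N) = begin
      D n z                                                  ≡⟨ go 1+n≤N ⟩
      ∑ℤ N f                                                 ≡⟨ +-identityʳ _ ⟨
      ∑ℤ N f + 0ℤ
        ≡⟨ cong (λ t → ∑ℤ N f + t * z ^ N) (k>n⇒delannoy≡0 (ℕ.≤′⇒≤ 1+n≤N)) ⟨
      ∑ℤ N f + f N                                           ≡⟨ ∑-last N f ⟨
      ∑ℤ (suc N) f                                           ∎
      where
      f : ℕ → ℤ
      f k = delannoy n k * z ^ k

  -- Compared coefficient by coefficient through `delannoy-recurrence`. At n = 0 the value `0 ∸ 1`
  -- is harmless, because that term carries the factor n.
  D-recurrence : ∀ n z → (1ℤ + + n) * D (suc n) z + + n * D (n ∸ 1) z ≡
                         (1ℤ + + 2 * + n) * (1ℤ + + 2 * z) * D n z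
  D-recurrence zero    z = eq z
    where
    eq : ∀ z → 1ℤ * (+ 1 * 1ℤ + (+ 2 * (z * 1ℤ) + 0ℤ)) + 0ℤ * (+ 1 * 1ℤ + 0ℤ) ≡
               (1ℤ + + 2 * 0ℤ) * (1ℤ + + 2 * z) * (+ 1 * 1ℤ + 0ℤ)
    eq = solve-∀
  D-recurrence (suc n) z = begin
    (1ℤ + + suc n) * D (suc (suc n)) z + + suc n * D n z
      ≡⟨ cong₂ (λ s t → (1ℤ + + suc n) * s + + suc n * t)
           (D-truncate (suc (suc n)) z ℕ.≤-refl) (D-truncate n z (ℕ.m≤n⇒m≤1+n (ℕ.m≤n⇒m≤1+n ℕ.≤-refl))) ⟩
    (1ℤ + (1ℤ + ν)) * (delannoy (suc (suc n)) 0 * 1ℤ + U₂) + (1ℤ + ν) * (delannoy n 0 * 1ℤ + U₀)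
      ≡⟨ cong₂ (λ s t → (1ℤ + (1ℤ + ν)) * (s * 1ℤ + U₂) + (1ℤ + ν) * (t * 1ℤ + U₀))
           (delannoy-0 (suc (suc n))) (delannoy-0 n) ⟩
    (1ℤ + (1ℤ + ν)) * (1ℤ * 1ℤ + U₂) + (1ℤ + ν) * (1ℤ * 1ℤ + U₀)
      ≡⟨ regroup ν U₂ U₀ ⟩
    (+ 3 + + 2 * ν) + ((+ 2 + ν) * U₂ + (1ℤ + ν) * U₀)
      ≡⟨ cong (_+_ (+ 3 + + 2 * ν)) tails ⟩
    (+ 3 + + 2 * ν) + (+ 3 + + 2 * ν) * (U₁ + + 2 * z * T₁)
      ≡⟨ collect ν z U₁ T₁ ⟩
    (+ 3 + + 2 * ν) * (1ℤ * 1ℤ + U₁) + (+ 3 + + 2 * ν) * (+ 2 * z) * T₁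
      ≡⟨ cong₂ (λ s t → (+ 3 + + 2 * ν) * (s * 1ℤ + U₁) + (+ 3 + + 2 * ν) * (+ 2 * z) * t)
           (sym (delannoy-0 (suc n))) (sym (D-truncate (suc n) z ℕ.≤-refl)) ⟩
    (+ 3 + + 2 * ν) * (delannoy (suc n) 0 * 1ℤ + U₁) + (+ 3 + + 2 * ν) * (+ 2 * z) * D (suc n) z
      ≡⟨ cong (λ t → (+ 3 + + 2 * ν) * t + (+ 3 + + 2 * ν) * (+ 2 * z) * D (suc n) z)
           (sym (D-truncate (suc n) z (ℕ.m≤n⇒m≤1+n ℕ.≤-refl))) ⟩
    (+ 3 + + 2 * ν) * D (suc n) z + (+ 3 + + 2 * ν) * (+ 2 * z) * D (suc n) z
      ≡⟨ factor ν z (D (suc n) z) ⟩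
    (1ℤ + + 2 * (1ℤ + ν)) * (1ℤ + + 2 * z) * D (suc n) z ∎
    where
    open ≡-Reasoning
    ν = + n
    N = suc (suc n)
    -- `U i` is `D i z` without its constant term 1, padded to a common length. `T₁` is the whole of
    -- `D (suc n) z`, one degree lower, since the factor 2z raises its degree by one.
    U : ℕ → ℤ
    U i = ∑ℤ[ k < N ] (delannoy i (suc k) * z ^ suc k)
    U₀ = U n
    U₁ = U (suc n)
    U₂ = U N
    T₁ = ∑ℤ[ k < N ] (delannoy (suc n) k * z ^ k)
    regroup : ∀ ν u v → (1ℤ + (1ℤ + ν)) * (1ℤ * 1ℤ + u) + (1ℤ + ν) * (1ℤ * 1ℤ + v) ≡
      (+ 3 + + 2 * ν) + ((+ 2 + ν) * u + (1ℤ + ν) * v)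
    regroup = solve-∀
    collect : ∀ ν z u t → (+ 3 + + 2 * ν) + (+ 3 + + 2 * ν) * (u + + 2 * z * t) ≡
      (+ 3 + + 2 * ν) * (1ℤ * 1ℤ + u) + (+ 3 + + 2 * ν) * (+ 2 * z) * t
    collect = solve-∀
    factor : ∀ ν z d → (+ 3 + + 2 * ν) * d + (+ 3 + + 2 * ν) * (+ 2 * z) * d ≡
      (1ℤ + + 2 * (1ℤ + ν)) * (1ℤ + + 2 * z) * d
    factor = solve-∀
    termwise : ∀ k →
      (+ 2 + ν) * (delannoy N (suc k) * z ^ suc k) + (1ℤ + ν) * (delannoy n (suc k) * z ^ suc k) ≡
      (+ 3 + + 2 * ν) * (delannoy (suc n) (suc k) * z ^ suc k + + 2 * z * (delannoy (suc n) k * z ^ k))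
    termwise k = begin
      (+ 2 + ν) * (delannoy N (suc k) * (z * w)) + (1ℤ + ν) * (delannoy n (suc k) * (z * w))
        ≡⟨ out (+ 2 + ν) (1ℤ + ν) (delannoy N (suc k)) (delannoy n (suc k)) (z * w) ⟩
      ((+ 2 + ν) * delannoy N (suc k) + (1ℤ + ν) * delannoy n (suc k)) * (z * w)
        ≡⟨ cong (_* (z * w)) (delannoy-recurrence n k) ⟩
      (+ 3 + + 2 * ν) * (delannoy (suc n) (suc k) + + 2 * delannoy (suc n) k) * (z * w)
        ≡⟨ inn (+ 3 + + 2 * ν) (delannoy (suc n) (suc k)) (delannoy (suc n) k) z w ⟩
      (+ 3 + + 2 * ν) * (delannoy (suc n) (suc k) * (z * w) + + 2 * z * (delannoy (suc n) k * w)) ∎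
      where
      w = z ^ k
      out : ∀ a b x y w → a * (x * w) + b * (y * w) ≡ (a * x + b * y) * w
      out = solve-∀
      inn : ∀ a x y z w → a * (x + + 2 * y) * (z * w) ≡ a * (x * (z * w) + + 2 * z * (y * w))
      inn = solve-∀
    tails : (+ 2 + ν) * U₂ + (1ℤ + ν) * U₀ ≡ (+ 3 + + 2 * ν) * (U₁ + + 2 * z * T₁)
    tails = begin
      (+ 2 + ν) * U₂ + (1ℤ + ν) * U₀
        ≡⟨ cong₂ _+_ (∑-*ˡ N (+ 2 + ν) (u N)) (∑-*ˡ N (1ℤ + ν) (u n)) ⟨
      ∑ℤ[ k < N ] ((+ 2 + ν) * u N k) + ∑ℤ[ k < N ] ((1ℤ + ν) * u n k)
        ≡⟨ ∑-+ N (λ k → (+ 2 + ν) * u N k) (λ k → (1ℤ + ν) * u n k) ⟨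
      ∑ℤ[ k < N ] ((+ 2 + ν) * u N k + (1ℤ + ν) * u n k)
        ≡⟨ ∑-cong N termwise ⟩
      ∑ℤ[ k < N ] ((+ 3 + + 2 * ν) * (u (suc n) k + + 2 * z * t k))
        ≡⟨ ∑-*ˡ N (+ 3 + + 2 * ν) (λ k → u (suc n) k + + 2 * z * t k) ⟩
      (+ 3 + + 2 * ν) * ∑ℤ[ k < N ] (u (suc n) k + + 2 * z * t k)
        ≡⟨ cong ((+ 3 + + 2 * ν) *_) (∑-+ N (u (suc n)) (λ k → + 2 * z * t k)) ⟩
      (+ 3 + + 2 * ν) * (U₁ + ∑ℤ[ k < N ] (+ 2 * z * t k))
        ≡⟨ cong (λ s → (+ 3 + + 2 * ν) * (U₁ + s)) (∑-*ˡ N (+ 2 * z) t) ⟩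
      (+ 3 + + 2 * ν) * (U₁ + + 2 * z * T₁) ∎
      where
      u : ℕ → ℕ → ℤ
      u i k = delannoy i (suc k) * z ^ suc k
      t : ℕ → ℤ
      t k = delannoy (suc n) k * z ^ k

  -- Replacing z by -1 - z negates 1 + 2z, so the recurrence passes the sign (-1)^n on from the two
  -- preceding values.
  D-reflect : ∀ n z → D n (-1ℤ - z) ≡ -1ℤ ^ n * D n z
  D-reflect zero          z = refl
  D-reflect (suc zero)    z = eq z
    where
    eq : ∀ z → + 1 * 1ℤ + (+ 2 * ((-1ℤ - z) * 1ℤ) + 0ℤ) ≡ -1ℤ * 1ℤ * (+ 1 * 1ℤ + (+ 2 * (z * 1ℤ) + 0ℤ))
    eq = solve-∀
  D-reflect (suc (suc n)) z = *-cancelˡ-≡ (1ℤ + (1ℤ + ν)) _ _ (begin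
    (1ℤ + (1ℤ + ν)) * D (suc (suc n)) z′
      ≡⟨ isolate _ ((1ℤ + ν) * D n z′) ⟩
    ((1ℤ + (1ℤ + ν)) * D (suc (suc n)) z′ + (1ℤ + ν) * D n z′) - (1ℤ + ν) * D n z′
      ≡⟨ cong (_- (1ℤ + ν) * D n z′) (D-recurrence (suc n) z′) ⟩
    (1ℤ + + 2 * (1ℤ + ν)) * (1ℤ + + 2 * z′) * D (suc n) z′ - (1ℤ + ν) * D n z′
      ≡⟨ cong₂ (λ s t → (1ℤ + + 2 * (1ℤ + ν)) * (1ℤ + + 2 * z′) * s - (1ℤ + ν) * t)
           (D-reflect (suc n) z) (D-reflect n z) ⟩
    (1ℤ + + 2 * (1ℤ + ν)) * (1ℤ + + 2 * z′) * (-1ℤ * σ * D (suc n) z) - (1ℤ + ν) * (σ * D n z)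
      ≡⟨ signs ν z σ (D (suc n) z) (D n z) ⟩
    σ * ((1ℤ + + 2 * (1ℤ + ν)) * (1ℤ + + 2 * z) * D (suc n) z - (1ℤ + ν) * D n z)
      ≡⟨ cong (λ t → σ * (t - (1ℤ + ν) * D n z)) (D-recurrence (suc n) z) ⟨
    σ * (((1ℤ + (1ℤ + ν)) * D (suc (suc n)) z + (1ℤ + ν) * D n z) - (1ℤ + ν) * D n z)
      ≡⟨ collect ν σ (D (suc (suc n)) z) (D n z) ⟩
    (1ℤ + (1ℤ + ν)) * (-1ℤ * (-1ℤ * σ) * D (suc (suc n)) z) ∎)
    where
    open ≡-Reasoning
    ν = + n
    z′ = -1ℤ - z
    σ = -1ℤ ^ n
    isolate : ∀ a b → a ≡ (a + b) - b
    isolate = solve-∀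
    signs : ∀ ν z σ x y →
      (1ℤ + + 2 * (1ℤ + ν)) * (1ℤ + + 2 * (-1ℤ - z)) * (-1ℤ * σ * x) - (1ℤ + ν) * (σ * y) ≡
      σ * ((1ℤ + + 2 * (1ℤ + ν)) * (1ℤ + + 2 * z) * x - (1ℤ + ν) * y)
    signs = solve-∀
    collect : ∀ ν σ x y → σ * (((1ℤ + (1ℤ + ν)) * x + (1ℤ + ν) * y) - (1ℤ + ν) * y) ≡
      (1ℤ + (1ℤ + ν)) * (-1ℤ * (-1ℤ * σ) * x)
    collect = solve-∀

  -- Summing the recurrence of D against a weight

  odd : ℕ → ℤ
  odd k = 1ℤ + + 2 * + k

  -- Summation by parts: multiply the recurrence by f(2k + 1) and collect the coefficient of each
  -- `D k z`, which moves the index shifts from D to f. Two terms remain at the upper end, with the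
  -- factor N; at the lower end the coefficient k is zero.
  ∑-telescope : ∀ (f : ℤ → ℤ) z N →
    ∑ℤ[ k < N ] (((1ℤ + + k) * f (odd k + + 2) + + k * f (odd k - + 2)
                  - odd k * (1ℤ + + 2 * z) * f (odd k)) * D k z) ≡
    + N * (f (odd N) * D (N ∸ 1) z - f (odd N - + 2) * D N z)
  ∑-telescope f z zero    = refl
  ∑-telescope f z (suc N) = begin
    ∑ℤ (suc N) g
      ≡⟨ ∑-last N g ⟩
    ∑ℤ N g + g N
      ≡⟨ cong (_+ g N) (∑-telescope f z N) ⟩
    ν * (f₀ * D (N ∸ 1) z - f₋ * D N z) + ((1ℤ + ν) * f₊ + ν * f₋ - odd N * (1ℤ + + 2 * z) * f₀) * D N z
      ≡⟨ regroup ν f₊ f₀ f₋ (odd N * (1ℤ + + 2 * z)) (D (N ∸ 1) z) (D N z) ⟩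
    (1ℤ + ν) * (f₊ * D N z) + f₀ * (ν * D (N ∸ 1) z - odd N * (1ℤ + + 2 * z) * D N z)
      ≡⟨ cong (λ t → (1ℤ + ν) * (f₊ * D N z) + f₀ * (ν * D (N ∸ 1) z - t)) (D-recurrence N z) ⟨
    (1ℤ + ν) * (f₊ * D N z) + f₀ * (ν * D (N ∸ 1) z - ((1ℤ + ν) * D (suc N) z + ν * D (N ∸ 1) z))
      ≡⟨ collect ν f₊ f₀ (D (N ∸ 1) z) (D N z) (D (suc N) z) ⟩
    (1ℤ + ν) * (f₊ * D N z - f₀ * D (suc N) z)
      ≡⟨ cong₂ (λ s t → (1ℤ + ν) * (f s * D N z - f t * D (suc N) z)) (shiftˡ ν) (shiftʳ ν) ⟩
    (1ℤ + ν) * (f (odd (suc N)) * D N z - f (odd (suc N) - + 2) * D (suc N) z) ∎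
    where
    open ≡-Reasoning
    ν = + N
    f₊ = f (odd N + + 2)
    f₀ = f (odd N)
    f₋ = f (odd N - + 2)
    g : ℕ → ℤ
    g k = ((1ℤ + + k) * f (odd k + + 2) + + k * f (odd k - + 2)
           - odd k * (1ℤ + + 2 * z) * f (odd k)) * D k z
    regroup : ∀ ν a b c r x y → ν * (b * x - c * y) + ((1ℤ + ν) * a + ν * c - r * b) * y ≡
      (1ℤ + ν) * (a * y) + b * (ν * x - r * y)
    regroup = solve-∀
    collect : ∀ ν a b x y w →
      (1ℤ + ν) * (a * y) + b * (ν * x - ((1ℤ + ν) * w + ν * x)) ≡ (1ℤ + ν) * (a * y - b * w)
    collect = solve-∀
    shiftˡ : ∀ ν → 1ℤ + + 2 * ν + + 2 ≡ 1ℤ + + 2 * (1ℤ + ν)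
    shiftˡ = solve-∀
    shiftʳ : ∀ ν → 1ℤ + + 2 * ν ≡ 1ℤ + + 2 * (1ℤ + ν) - + 2
    shiftʳ = solve-∀

  -- The binomial identity behind the coefficients e

  2*n≡n+n : ∀ n → 2 ℕ.* n ≡ n ℕ.+ n
  2*n≡n+n n = cong (n ℕ.+_) (ℕ.+-identityʳ n)

  e-suc : ∀ s i → + e s (suc i) ≡
    s ℂ suc (suc (i ℕ.+ i)) * (+ 2 * (+ 2) ^ (i ℕ.+ i)) + s ℂ suc (i ℕ.+ i) * (+ 2) ^ (i ℕ.+ i)
  e-suc s i = begin
    + ((s C (2 ℕ.* suc i)) ℕ.* 2 ℕ.^ (2 ℕ.* suc i ∸ 1) ℕ.+ (s C (2 ℕ.* suc i ∸ 1)) ℕ.* 2 ℕ.^ (2 ℕ.* suc i ∸ 2))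
      ≡⟨ cong (λ j → + ((s C j) ℕ.* 2 ℕ.^ (j ∸ 1) ℕ.+ (s C (j ∸ 1)) ℕ.* 2 ℕ.^ (j ∸ 2)))
           (trans (2*n≡n+n (suc i)) (cong suc (ℕ.+-suc i i))) ⟩
    + ((s C suc (suc j)) ℕ.* 2 ℕ.^ suc j ℕ.+ (s C suc j) ℕ.* 2 ℕ.^ j)
      ≡⟨ pos-+ ((s C suc (suc j)) ℕ.* 2 ℕ.^ suc j) _ ⟩
    + ((s C suc (suc j)) ℕ.* 2 ℕ.^ suc j) + + ((s C suc j) ℕ.* 2 ℕ.^ j)
      ≡⟨ cong₂ _+_ (trans (pos-* (s C suc (suc j)) _) (cong₂ _*_ (sym (ℂ≡C s (suc (suc j)))) (pos-^ 2 (suc j))))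
                   (trans (pos-* (s C suc j) _) (cong₂ _*_ (sym (ℂ≡C s (suc j))) (pos-^ 2 j))) ⟩
    s ℂ suc (suc j) * (+ 2) ^ suc j + s ℂ suc j * (+ 2) ^ j ∎
    where
    open ≡-Reasoning
    j = i ℕ.+ i

  -2^[i+i] : ∀ i → (- + 2) ^ (i ℕ.+ i) ≡ (+ 2) ^ (i ℕ.+ i)
  -2^[i+i] i = trans (square (- + 2)) (sym (square (+ 2)))
    where
    square : ∀ x → x ^ (i ℕ.+ i) ≡ (x ^ 2) ^ i
    square x = trans (cong (x ^_) (sym (2*n≡n+n i))) (sym (^-*-assoc x 2 i))

  -- This explains the shape of e. Expand both powers in powers of ±2: the odd degrees keep only the
  -- multiples ±1 of the outer factors, the even degrees only the multiples x. With v = w + 1,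
  -- degrees 2j - 1 and 2j thus both give 2 x^(2v - 2j), times C(s, 2j - 1) 2^(2j - 1) and C(s, 2j)
  -- 2^(2j), and these two add up to twice e_j. Degree 0 is the subtracted term.
  ∑-e : ∀ w x → let s = suc (w ℕ.+ w) in
    + 4 * ∑ℤ[ i < suc w ] (+ e s (suc i) * x ^ (2 ℕ.* (w ∸ i))) ≡
    (x + 1ℤ) * (x + + 2) ^ s + (x - 1ℤ) * (x - + 2) ^ s - + 2 * (x * x ^ s)
  ∑-e w x = begin
    + 4 * ∑ℤ[ i < suc w ] (+ e s (suc i) * x ^ (2 ℕ.* (w ∸ i)))
      ≡⟨ ∑-*ˡ (suc w) (+ 4) (λ i → + e s (suc i) * x ^ (2 ℕ.* (w ∸ i))) ⟨
    ∑ℤ[ i < suc w ] (+ 4 * (+ e s (suc i) * x ^ (2 ℕ.* (w ∸ i))))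
      ≡⟨ ∑-cong< (suc w) (λ i i<1+w → termwise i (ℕ.s≤s⁻¹ i<1+w)) ⟩
    ∑ℤ[ i < suc w ] (h (suc (i ℕ.+ i)) + h (suc (suc (i ℕ.+ i))))
      ≡⟨ ∑-pairs (suc w) (h ∘ suc) ⟨
    ∑ℤ (suc w ℕ.+ suc w) (h ∘ suc)
      ≡⟨ cong (λ n → ∑ℤ (suc n) (h ∘ suc)) (ℕ.+-suc w w) ⟩
    ∑ℤ (suc s) (h ∘ suc)
      ≡⟨ isolate (h 0) _ ⟩
    ∑ℤ (suc (suc s)) h - h 0
      ≡⟨ cong₂ _-_ (∑-last (suc s) h) h0 ⟩
    ∑ℤ (suc s) h + h (suc s) - + 2 * (x * x ^ s)
      ≡⟨ cong (λ t → ∑ℤ (suc s) h + t - + 2 * (x * x ^ s)) h-end ⟩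
    ∑ℤ (suc s) h + 0ℤ - + 2 * (x * x ^ s)
      ≡⟨ cong (_- + 2 * (x * x ^ s)) (+-identityʳ (∑ℤ (suc s) h)) ⟩
    ∑ℤ (suc s) h - + 2 * (x * x ^ s)
      ≡⟨ cong (_- + 2 * (x * x ^ s)) expand ⟨
    (x + 1ℤ) * (x + + 2) ^ s + (x - 1ℤ) * (x - + 2) ^ s - + 2 * (x * x ^ s) ∎
    where
    open ≡-Reasoning
    s = suc (w ℕ.+ w)
    t : ℤ → ℕ → ℤ
    t a k = s ℂ k * (a ^ k * x ^ (s ∸ k))
    h : ℕ → ℤ
    h k = (x + 1ℤ) * t (+ 2) k + (x - 1ℤ) * t (- + 2) k
    isolate : ∀ a b → b ≡ a + b - a
    isolate = solve-∀
    h0 : h 0 ≡ + 2 * (x * x ^ s)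
    h0 = trans (cong (λ c → (x + 1ℤ) * (c * (1ℤ * x ^ s)) + (x - 1ℤ) * (c * (1ℤ * x ^ s))) (nℂ0≡1 s)) (eq x (x ^ s))
      where
      eq : ∀ x y → (x + 1ℤ) * (1ℤ * (1ℤ * y)) + (x - 1ℤ) * (1ℤ * (1ℤ * y)) ≡ + 2 * (x * y)
      eq = solve-∀
    t-end : ∀ a → t a (suc s) ≡ 0ℤ
    t-end a = cong (_* (a ^ suc s * x ^ (s ∸ suc s))) (k>n⇒nℂk≡0 ℕ.≤-refl)
    -- Degrees 1 to s are odd in number; the vanishing degree s + 1 completes the last pair.
    h-end : h (suc s) ≡ 0ℤ
    h-end = trans (cong₂ (λ u v → (x + 1ℤ) * u + (x - 1ℤ) * v) (t-end (+ 2)) (t-end (- + 2))) (eq x)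
      where
      eq : ∀ x → (x + 1ℤ) * 0ℤ + (x - 1ℤ) * 0ℤ ≡ 0ℤ
      eq = solve-∀
    expand : (x + 1ℤ) * (x + + 2) ^ s + (x - 1ℤ) * (x - + 2) ^ s ≡ ∑ℤ (suc s) h
    expand = begin
      (x + 1ℤ) * (x + + 2) ^ s + (x - 1ℤ) * (x - + 2) ^ s
        ≡⟨ cong₂ (λ u v → (x + 1ℤ) * u + (x - 1ℤ) * v) (power (+ 2)) (power (- + 2)) ⟩
      (x + 1ℤ) * ∑ℤ (suc s) (t (+ 2)) + (x - 1ℤ) * ∑ℤ (suc s) (t (- + 2))
        ≡⟨ cong₂ _+_ (∑-*ˡ (suc s) (x + 1ℤ) (t (+ 2))) (∑-*ˡ (suc s) (x - 1ℤ) (t (- + 2))) ⟨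
      ∑ℤ[ k < suc s ] ((x + 1ℤ) * t (+ 2) k) + ∑ℤ[ k < suc s ] ((x - 1ℤ) * t (- + 2) k)
        ≡⟨ ∑-+ (suc s) (λ k → (x + 1ℤ) * t (+ 2) k) (λ k → (x - 1ℤ) * t (- + 2) k) ⟨
      ∑ℤ (suc s) h ∎
      where
      power : ∀ a → (x + a) ^ s ≡ ∑ℤ (suc s) (t a)
      power a = trans (cong (_^ s) (+-comm x a)) (binomial-theorem s a x)
    termwise : ∀ i → i ℕ.≤ w → + 4 * (+ e s (suc i) * x ^ (2 ℕ.* (w ∸ i))) ≡ h (suc (i ℕ.+ i)) + h (suc (suc (i ℕ.+ i)))
    termwise i i≤w = begin
      + 4 * (+ e s (suc i) * y)
        ≡⟨ cong (λ u → + 4 * (u * y)) (e-suc s i) ⟩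
      + 4 * ((c₂ * (+ 2 * b) + c₁ * b) * y)
        ≡⟨ prepare b c₁ c₂ y ⟩
      + 2 * (c₁ * (+ 2 * b * y)) + + 2 * (+ 2 * (+ 2 * b) * (c₂ * y))
        ≡⟨ cong₂ (λ u v → + 2 * (c₁ * (+ 2 * b * u)) + + 2 * (+ 2 * (+ 2 * b) * v)) (cong (x ^_) exponent) (even-exponent (ℕ.m≤n⇒m<n∨m≡n i≤w)) ⟩
      + 2 * (c₁ * (+ 2 * b * y₁)) + + 2 * (+ 2 * (+ 2 * b) * (c₂ * (x * y₂)))
        ≡⟨ finish x b c₁ c₂ y₁ y₂ ⟩
      (x + 1ℤ) * (c₁ * (+ 2 * b * y₁)) + (x - 1ℤ) * (c₁ * (- + 2 * b * y₁)) +
      ((x + 1ℤ) * (c₂ * (+ 2 * (+ 2 * b) * y₂)) + (x - 1ℤ) * (c₂ * (- + 2 * (- + 2 * b) * y₂)))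
        ≡⟨ cong (λ b′ → (x + 1ℤ) * (c₁ * (+ 2 * b * y₁)) + (x - 1ℤ) * (c₁ * (- + 2 * b′ * y₁)) +
                        ((x + 1ℤ) * (c₂ * (+ 2 * (+ 2 * b) * y₂)) + (x - 1ℤ) * (c₂ * (- + 2 * (- + 2 * b′) * y₂))))
                (-2^[i+i] i) ⟨
      h (suc (i ℕ.+ i)) + h (suc (suc (i ℕ.+ i))) ∎
      where
      j = i ℕ.+ i
      b = (+ 2) ^ j
      c₁ = s ℂ suc j
      c₂ = s ℂ suc (suc j)
      y = x ^ (2 ℕ.* (w ∸ i))
      y₁ = x ^ (w ℕ.+ w ∸ j)
      y₂ = x ^ (w ℕ.+ w ∸ suc j)
      exponent : 2 ℕ.* (w ∸ i) ≡ w ℕ.+ w ∸ j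
      exponent = trans (ℕ.*-distribˡ-∸ 2 w i) (cong₂ _∸_ (2*n≡n+n w) (2*n≡n+n i))
      even-exponent : i ℕ.< w ⊎ i ≡ w → c₂ * y ≡ c₂ * (x * y₂)
      even-exponent (inj₁ i<w) = cong (c₂ *_) (cong (x ^_) (trans exponent
        (ℕ.+-∸-assoc 1 (ℕ.+-mono-< i<w i<w))))
      -- Here the subtraction in the exponent of `y₂` truncates, but C(s, s + 1) = 0 makes both
      -- sides zero.
      even-exponent (inj₂ refl) = trans (cong (_* y) c₂≡0) (cong (_* (x * y₂)) (sym c₂≡0))
        where
        c₂≡0 : c₂ ≡ 0ℤ
        c₂≡0 = k>n⇒nℂk≡0 ℕ.≤-refl
      prepare : ∀ b c d y → + 4 * ((d * (+ 2 * b) + c * b) * y) ≡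
        + 2 * (c * (+ 2 * b * y)) + + 2 * (+ 2 * (+ 2 * b) * (d * y))
      prepare = solve-∀
      finish : ∀ x b c d y z → + 2 * (c * (+ 2 * b * y)) + + 2 * (+ 2 * (+ 2 * b) * (d * (x * z))) ≡
        (x + 1ℤ) * (c * (+ 2 * b * y)) + (x - 1ℤ) * (c * (- + 2 * b * y)) +
        ((x + 1ℤ) * (d * (+ 2 * (+ 2 * b) * z)) + (x - 1ℤ) * (d * (- + 2 * (- + 2 * b) * z)))
      finish = solve-∀

  -- Column sums of the Delannoy coefficients

  ∑-delannoy : ∀ N j → (1ℤ + + 2 * + j) * ∑ℤ[ n < N ] (delannoy n j) ≡ (+ N - + j) * delannoy N j
  ∑-delannoy zero    zero    = refl
  ∑-delannoy zero    (suc j) = trans (*-zeroʳ (1ℤ + + 2 * + suc j))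
    (sym (trans (cong ((0ℤ - + suc j) *_) (k>n⇒delannoy≡0 (s≤s z≤n))) (*-zeroʳ (0ℤ - + suc j))))
  ∑-delannoy (suc N) j = begin
    (1ℤ + + 2 * + j) * ∑ℤ (suc N) d             ≡⟨ cong ((1ℤ + + 2 * + j) *_) (∑-last N d) ⟩
    (1ℤ + + 2 * + j) * (∑ℤ N d + d N)           ≡⟨ *-distribˡ-+ (1ℤ + + 2 * + j) (∑ℤ N d) (d N) ⟩
    (1ℤ + + 2 * + j) * ∑ℤ N d + (1ℤ + + 2 * + j) * d N
      ≡⟨ cong (_+ (1ℤ + + 2 * + j) * d N) (∑-delannoy N j) ⟩
    -- The coefficients add up to 1 + N + j, the factor on the right of `delannoy-sucˡ`.
    (+ N - + j) * d N + (1ℤ + + 2 * + j) * d N  ≡⟨ eq (+ N) (+ j) (d N) ⟩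
    (1ℤ + + N + + j) * d N                      ≡⟨ delannoy-sucˡ N j ⟨
    (1ℤ + + N - + j) * d (suc N)                ∎
    where
    open ≡-Reasoning
    d : ℕ → ℤ
    d n = delannoy n j
    eq : ∀ n j d → (n - j) * d + (1ℤ + + 2 * j) * d ≡ (1ℤ + n + j) * d
    eq = solve-∀

  -- Iterated from j = 0, this expresses (N - j) `delannoy N j` as N times the product of (N² - i²)
  -- / i² over 1 ≤ i ≤ j. For N = p and j < p every factor is -1 modulo p, whence the sign in
  -- `[p-j]*delannoy`.
  [N-j]*delannoy-suc : ∀ N j → let κ = 1ℤ + + j in
    κ * (κ * ((+ N - κ) * delannoy N (suc j))) ≡ (+ N - κ) * (+ N + κ) * ((+ N - + j) * delannoy N j)
  [N-j]*delannoy-suc N j = begin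
    κ * (κ * ((ν - κ) * delannoy N (suc j)))              ≡⟨ eq₁ ν κ (delannoy N (suc j)) ⟩
    (ν - κ) * (κ * κ * delannoy N (suc j))                ≡⟨ cong ((ν - κ) *_) (delannoy-sucʳ N j) ⟩
    (ν - κ) * ((ν - + j) * (1ℤ + ν + + j) * delannoy N j) ≡⟨ eq₂ ν (+ j) (delannoy N j) ⟩
    (ν - κ) * (ν + κ) * ((ν - + j) * delannoy N j)        ∎
    where
    open ≡-Reasoning
    ν = + N
    κ = 1ℤ + + j
    eq₁ : ∀ ν κ d → κ * (κ * ((ν - κ) * d)) ≡ (ν - κ) * (κ * κ * d)
    eq₁ = solve-∀
    eq₂ : ∀ ν j d → (ν - (1ℤ + j)) * ((ν - j) * (1ℤ + ν + j) * d) ≡ (ν - (1ℤ + j)) * (ν + (1ℤ + j)) * ((ν - j) * d)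
    eq₂ = solve-∀

  ^-neg : ∀ z k → (- z) ^ k ≡ -1ℤ ^ k * z ^ k
  ^-neg z zero    = refl
  ^-neg z (suc k) = trans (cong (- z *_) (^-neg z k)) (eq z (-1ℤ ^ k) (z ^ k))
    where
    eq : ∀ z s w → - z * (s * w) ≡ -1ℤ * s * (z * w)
    eq = solve-∀

  -- Moments and their recurrence in ℤ

  moment : ℕ → ℤ → ℕ → ℤ
  moment p z v = ∑ℤ[ k < p ] (+ ((2 ℕ.* k ℕ.+ 1) ℕ.^ (2 ℕ.* v)) * D k z)

  odd^ : ∀ k n → + ((2 ℕ.* k ℕ.+ 1) ℕ.^ n) ≡ odd k ^ n
  odd^ k n = trans (pos-^ (2 ℕ.* k ℕ.+ 1) n) (cong (_^ n)
    (trans (cong (+_) (ℕ.+-comm (2 ℕ.* k) 1)) (cong (_+_ 1ℤ) (pos-* 2 k))))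

  -- With x = 2k + 1, the factors x + 1 and x - 1 are 2(k + 1) and 2k. So the right side of `∑-e` is
  -- twice the weight in `∑-telescope` for f(x) = x^s, plus 4z x^(s + 1), which offsets the 2z
  -- inside 1 + 2z. The quotient q is twice the boundary term.
  ∑-e-moment : ∀ N z w → ∃[ q ]
    + 4 * ∑ℤ[ i < suc w ] (+ e (2 ℕ.* suc w ∸ 1) (suc i) * moment N z (w ∸ i)) ≡
    q * + N + + 4 * z * moment N z (suc w)
  ∑-e-moment N z w = + 2 * boundary , (begin
    + 4 * ∑ℤ[ i < suc w ] (+ e (2 ℕ.* suc w ∸ 1) (suc i) * moment N z (w ∸ i))
      ≡⟨ cong (λ s → + 4 * ∑ℤ[ i < suc w ] (+ e s (suc i) * moment N z (w ∸ i))) s≡ ⟩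
    + 4 * ∑ℤ[ i < suc w ] (E i * moment N z (w ∸ i))
      ≡⟨ cong (λ t → + 4 * t) swap ⟩
    + 4 * ∑ℤ[ k < N ] (∑ℤ[ i < suc w ] (E i * odd k ^ (2 ℕ.* (w ∸ i))) * D k z)
      ≡⟨ ∑-*ˡ N (+ 4) (λ k → ∑ℤ[ i < suc w ] (E i * odd k ^ (2 ℕ.* (w ∸ i))) * D k z) ⟨
    ∑ℤ[ k < N ] (+ 4 * (∑ℤ[ i < suc w ] (E i * odd k ^ (2 ℕ.* (w ∸ i))) * D k z))
      ≡⟨ ∑-cong N termwise ⟩
    ∑ℤ[ k < N ] (+ 2 * G k + + 4 * z * (odd k ^ (2 ℕ.* suc w) * D k z))
      ≡⟨ ∑-+ N (λ k → + 2 * G k) (λ k → + 4 * z * (odd k ^ (2 ℕ.* suc w) * D k z)) ⟩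
    ∑ℤ[ k < N ] (+ 2 * G k) + ∑ℤ[ k < N ] (+ 4 * z * (odd k ^ (2 ℕ.* suc w) * D k z))
      ≡⟨ cong₂ _+_ (∑-*ˡ N (+ 2) G) (∑-*ˡ N (+ 4 * z) (λ k → odd k ^ (2 ℕ.* suc w) * D k z)) ⟩
    + 2 * ∑ℤ N G + + 4 * z * ∑ℤ[ k < N ] (odd k ^ (2 ℕ.* suc w) * D k z)
      ≡⟨ cong₂ (λ u v → + 2 * u + + 4 * z * v) (∑-telescope (_^ s) z N) (sym (moment≡ (suc w))) ⟩
    + 2 * (+ N * boundary) + + 4 * z * moment N z (suc w)
      ≡⟨ cong (_+ + 4 * z * moment N z (suc w)) (eq (+ N) boundary) ⟩
    + 2 * boundary * + N + + 4 * z * moment N z (suc w) ∎)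
    where
    open ≡-Reasoning
    s = suc (w ℕ.+ w)
    s≡ : 2 ℕ.* suc w ∸ 1 ≡ s
    s≡ = cong (_∸ 1) (trans (2*n≡n+n (suc w)) (cong suc (ℕ.+-suc w w)))
    boundary = odd N ^ s * D (N ∸ 1) z - (odd N - + 2) ^ s * D N z
    E : ℕ → ℤ
    E i = + e s (suc i)
    G : ℕ → ℤ
    G k = ((1ℤ + + k) * (odd k + + 2) ^ s + + k * (odd k - + 2) ^ s
           - odd k * (1ℤ + + 2 * z) * odd k ^ s) * D k z
    eq : ∀ n b → + 2 * (n * b) ≡ + 2 * b * n
    eq = solve-∀
    moment≡ : ∀ v → moment N z v ≡ ∑ℤ[ k < N ] (odd k ^ (2 ℕ.* v) * D k z)
    moment≡ v = ∑-cong N (λ k → cong (_* D k z) (odd^ k (2 ℕ.* v)))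
    swap : ∑ℤ[ i < suc w ] (E i * moment N z (w ∸ i)) ≡
           ∑ℤ[ k < N ] (∑ℤ[ i < suc w ] (E i * odd k ^ (2 ℕ.* (w ∸ i))) * D k z)
    swap = begin
      ∑ℤ[ i < suc w ] (E i * moment N z (w ∸ i))
        ≡⟨ ∑-cong (suc w) (λ i → trans (cong (E i *_) (moment≡ (w ∸ i)))
              (trans (sym (∑-*ˡ N (E i) (λ k → odd k ^ (2 ℕ.* (w ∸ i)) * D k z)))
                (∑-cong N (λ k → sym (*-assoc (E i) (odd k ^ (2 ℕ.* (w ∸ i))) (D k z)))))) ⟩
      ∑ℤ[ i < suc w ] (∑ℤ[ k < N ] (E i * odd k ^ (2 ℕ.* (w ∸ i)) * D k z))
        ≡⟨ ∑-swap (suc w) N (λ i k → E i * odd k ^ (2 ℕ.* (w ∸ i)) * D k z) ⟩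
      ∑ℤ[ k < N ] (∑ℤ[ i < suc w ] (E i * odd k ^ (2 ℕ.* (w ∸ i)) * D k z))
        ≡⟨ ∑-cong N (λ k → ∑-*ʳ (suc w) (D k z) (λ i → E i * odd k ^ (2 ℕ.* (w ∸ i)))) ⟩
      ∑ℤ[ k < N ] (∑ℤ[ i < suc w ] (E i * odd k ^ (2 ℕ.* (w ∸ i))) * D k z) ∎
    termwise : ∀ k → + 4 * (∑ℤ[ i < suc w ] (E i * odd k ^ (2 ℕ.* (w ∸ i))) * D k z) ≡
                     + 2 * G k + + 4 * z * (odd k ^ (2 ℕ.* suc w) * D k z)
    termwise k = begin
      + 4 * (∑ℤ[ i < suc w ] (E i * odd k ^ (2 ℕ.* (w ∸ i))) * D k z)
        ≡⟨ *-assoc (+ 4) (∑ℤ[ i < suc w ] (E i * odd k ^ (2 ℕ.* (w ∸ i)))) (D k z) ⟨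
      + 4 * ∑ℤ[ i < suc w ] (E i * odd k ^ (2 ℕ.* (w ∸ i))) * D k z
        ≡⟨ cong (_* D k z) (∑-e w (odd k)) ⟩
      ((odd k + 1ℤ) * (odd k + + 2) ^ s + (odd k - 1ℤ) * (odd k - + 2) ^ s - + 2 * (odd k * odd k ^ s)) * D k z
        ≡⟨ eq₁ (+ k) z ((odd k + + 2) ^ s) ((odd k - + 2) ^ s) (odd k ^ s) (D k z) ⟩
      + 2 * G k + + 4 * z * (odd k * odd k ^ s * D k z)
        ≡⟨ cong (λ n → + 2 * G k + + 4 * z * (odd k ^ n * D k z)) (cong suc s≡) ⟨
      + 2 * G k + + 4 * z * (odd k ^ (2 ℕ.* suc w) * D k z) ∎
      where
      eq₁ : ∀ k z a b c d →
        ((1ℤ + + 2 * k + 1ℤ) * a + (1ℤ + + 2 * k - 1ℤ) * b - + 2 * ((1ℤ + + 2 * k) * c)) * d ≡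
        + 2 * (((1ℤ + k) * a + k * b - (1ℤ + + 2 * k) * (1ℤ + + 2 * z) * c) * d) + + 4 * z * ((1ℤ + + 2 * k) * c * d)
      eq₁ = solve-∀

  -- Moments modulo an odd prime

  module OddPrimeModulus (p : ℕ) (p-prime : Prime p) {m : ℕ} (p≡1+m+m : p ≡ suc (m ℕ.+ m)) where

    open PrimeModulus p p-prime public
    open SetoidReasoning ≈-setoid

    p∤2 : ¬ (+ p ∣ + 2)
    p∤2 p∣2 = no-m m p≡1+m+m
      where
      no-m : ∀ m → ¬ (p ≡ suc (m ℕ.+ m))
      no-m zero    p≡1 = ℕ.<⇒≢ 1<p (sym p≡1)
      no-m (suc m) p≡  = p∤small {2} (s≤s z≤n)
        (subst (2 ℕ.<_) (sym p≡) (s≤s (s≤s (subst (1 ℕ.≤_) (sym (ℕ.+-suc m m)) (s≤s z≤n))))) p∣2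

    -- When 1 + 2j = p, the quotient f is ∑_{n<p} delannoy n j, by ∑-delannoy.
    [p-j]*delannoy : ∀ j → j ℕ.< p →
      ∃[ f ] ((+ p - + j) * delannoy p j ≡ f * + p) × (f ≈ -1ℤ ^ j)
    [p-j]*delannoy zero    _ = 1ℤ , trans (cong ((+ p - 0ℤ) *_) (delannoy-0 p)) (eq (+ p)) , ≡⇒≈ refl
      where
      eq : ∀ p → (p - 0ℤ) * 1ℤ ≡ 1ℤ * p
      eq = solve-∀
    [p-j]*delannoy (suc j) 1+j<p with [p-j]*delannoy j (ℕ.<-trans ℕ.≤-refl 1+j<p)
    ... | f , f≡ , f≈ = next ([ ⊥-elim ∘ p∤1+j , [ ⊥-elim ∘ p∤1+j , id ]′ ∘ euclid κ _ ]′ (euclid κ _ p∣))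
      where
      instance _ = prime⇒nonZero p-prime
      κ = 1ℤ + + j
      π = + p
      p∤1+j : ¬ (π ∣ κ)
      p∤1+j = p∤small (s≤s z≤n) 1+j<p
      step : κ * (κ * ((π - κ) * delannoy p (suc j))) ≡ (π - κ) * (π + κ) * f * π
      step = trans ([N-j]*delannoy-suc p j)
        (trans (cong ((π - κ) * (π + κ) *_) f≡) (sym (*-assoc ((π - κ) * (π + κ)) f π)))
      p∣ : π ∣ κ * (κ * ((π - κ) * delannoy p (suc j)))
      p∣ = divides ((π - κ) * (π + κ) * f) step
      next : π ∣ (π - κ) * delannoy p (suc j) →
             ∃[ g ] ((π - κ) * delannoy p (suc j) ≡ g * π) × (g ≈ -1ℤ * -1ℤ ^ j)
      next (divides g g≡) = g , g≡ , *-cancelˡ κ p∤1+j (*-cancelˡ κ p∤1+j (begin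
        -- The common factor `π` is cancelled in ℤ first; modulo p the equation would read 0 = 0.
        κ * (κ * g)                   ≡⟨ *-cancelʳ-≡ _ _ π (trans (eq κ g π) (trans (cong (λ t → κ * (κ * t)) (sym g≡)) step)) ⟩
        (π - κ) * (π + κ) * f         ≈⟨ *-cong (*-cong (+-cong π≈0 (≡⇒≈ { - κ} refl)) (+-cong π≈0 (≡⇒≈ {κ} refl))) f≈ ⟩
        (0ℤ - κ) * (0ℤ + κ) * -1ℤ ^ j ≡⟨ eq′ κ (-1ℤ ^ j) ⟩
        κ * (κ * (-1ℤ * -1ℤ ^ j))     ∎))
        where
        π≈0 : π ≈ 0ℤ
        π≈0 = ∣⇒≈0 ∣-refl
        eq : ∀ κ g π → κ * (κ * g) * π ≡ κ * (κ * (g * π))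
        eq = solve-∀
        eq′ : ∀ κ s → (0ℤ - κ) * (0ℤ + κ) * s ≡ κ * (κ * (-1ℤ * s))
        eq′ = solve-∀

    -- From j < p follows 1 + 2j < 2p, so the only possible multiple is p itself, and p = 1 + 2m.
    p∣1+2j⇒j≡m : ∀ {j} → j ℕ.< p → + p ∣ 1ℤ + + 2 * + j → j ≡ m
    p∣1+2j⇒j≡m {j} j<p d = helper (∣⇒∣ᵤ (∣-subst (cong (_+_ 1ℤ) (sym (pos-* 2 j))) d))
      where
      helper : p ℕ.∣ suc (2 ℕ.* j) → j ≡ m
      helper (ℕ.divides (suc zero) eq) = ℕ.*-cancelˡ-≡ j m 2
        (ℕ.suc-injective (trans eq (trans (ℕ.+-identityʳ p) (trans p≡1+m+m (cong suc (sym (2*n≡n+n m)))))))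
      helper (ℕ.divides (suc (suc q)) eq) = contradiction eq (ℕ.<⇒≢ (ℕ.<-≤-trans
        (subst (ℕ._< p ℕ.+ p) (cong suc (sym (2*n≡n+n j))) (subst (ℕ._≤ p ℕ.+ p) (cong suc (ℕ.+-suc j j)) (ℕ.+-mono-≤ j<p j<p)))
        (ℕ.+-monoʳ-≤ p (ℕ.m≤m+n p (q ℕ.* p)))))

    -- `∑-delannoy` gives (1 + 2j) B = f p for the column sum B. Either p is prime to 1 + 2j and
    -- must divide B, or 1 + 2j is p and cancels exactly, leaving B = f.
    ∑-delannoy≈ : ∀ j → j ℕ.< p →
      (j ≢ m → ∑ℤ[ n < p ] (delannoy n j) ≈ 0ℤ) × (j ≡ m → ∑ℤ[ n < p ] (delannoy n j) ≈ -1ℤ ^ j)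
    ∑-delannoy≈ j j<p with [p-j]*delannoy j j<p
    ... | f , f≡ , f≈ =
      (λ j≢m → [ (λ d → contradiction (p∣1+2j⇒j≡m j<p d) j≢m) , ∣⇒≈0 ]′ (euclid (1ℤ + + 2 * + j) B (divides f eq))) ,
      (λ j≡m → ≈-trans (≡⇒≈ (*-cancelˡ-≡ (+ p) B f (trans (cong (_* B) (p≡ j≡m)) (trans eq (*-comm f (+ p)))))) f≈)
      where
      instance _ = prime⇒nonZero p-prime
      B = ∑ℤ[ n < p ] (delannoy n j)
      eq : (1ℤ + + 2 * + j) * B ≡ f * + p
      eq = trans (∑-delannoy p j) f≡
      p≡ : j ≡ m → + p ≡ 1ℤ + + 2 * + j
      p≡ refl = trans (cong (+_) (trans p≡1+m+m (cong suc (sym (2*n≡n+n j))))) (cong (_+_ 1ℤ) (pos-* 2 j))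

    moment-0 : ∀ z → ¬ (+ p ∣ - z) → moment p z 0 ≈ legendre (- z) p
    moment-0 z p∤-z = begin
      ∑ℤ[ n < p ] (1ℤ * D n z)
        -- Padding every polynomial to p coefficients makes the double sum rectangular, ready for
        -- the exchange.
        ≡⟨ ∑-cong< p (λ n n<p → trans (*-identityˡ (D n z)) (D-truncate n z n<p)) ⟩
      ∑ℤ[ n < p ] (∑ℤ[ j < p ] (delannoy n j * z ^ j))
        ≡⟨ ∑-swap p p (λ n j → delannoy n j * z ^ j) ⟩
      ∑ℤ[ j < p ] (∑ℤ[ n < p ] (delannoy n j * z ^ j))
        ≡⟨ ∑-cong p (λ j → ∑-*ʳ p (z ^ j) (λ n → delannoy n j)) ⟩
      ∑ℤ[ j < p ] (∑ℤ[ n < p ] (delannoy n j) * z ^ j)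
        ≈⟨ ∑-single≈ p m<p (λ j j<p j≢m → *-cong (proj₁ (∑-delannoy≈ j j<p) j≢m) (≡⇒≈ refl)) ⟩
      ∑ℤ[ n < p ] (delannoy n m) * z ^ m
        ≈⟨ *-cong (proj₂ (∑-delannoy≈ m m<p) refl) (≡⇒≈ refl) ⟩
      -1ℤ ^ m * z ^ m
        ≡⟨ ^-neg z m ⟨
      (- z) ^ m
        ≈⟨ euler-criterion {m} p≡1+m+m p∤-z ⟩
      legendre (- z) p ∎
      where
      m<p : m ℕ.< p
      m<p = subst (m ℕ.<_) (sym p≡1+m+m) (s≤s (ℕ.m≤m+n m m))

    -- The boundary term of `∑-e-moment` is a multiple of p, and the factor 4 is cancelled as 2
    -- twice because p is odd.
    moment-suc : ∀ z w →
      z * moment p z (suc w) ≈ ∑ℤ[ i < suc w ] (+ e (2 ℕ.* suc w ∸ 1) (suc i) * moment p z (w ∸ i))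
    moment-suc z w = ≈-sym (*-cancelˡ (+ 2) p∤2 (*-cancelˡ (+ 2) p∤2 (begin
      + 2 * (+ 2 * Σe)                              ≡⟨ *-assoc (+ 2) (+ 2) Σe ⟨
      + 4 * Σe                                      ≡⟨ proj₂ (∑-e-moment p z w) ⟩
      q * + p + + 4 * z * moment p z (suc w)        ≈⟨ +-cong (∣⇒≈0 (∣n⇒∣m*n q ∣-refl)) (≡⇒≈ refl) ⟩
      0ℤ + + 4 * z * moment p z (suc w)             ≡⟨ eq z (moment p z (suc w)) ⟩
      + 2 * (+ 2 * (z * moment p z (suc w)))        ∎)))
      where
      q = proj₁ (∑-e-moment p z w)
      Σe = ∑ℤ[ i < suc w ] (+ e (2 ℕ.* suc w ∸ 1) (suc i) * moment p z (w ∸ i))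
      eq : ∀ z u → 0ℤ + + 4 * z * u ≡ + 2 * (+ 2 * (z * u))
      eq = solve-∀

  -- Congruences between integers and rationals

  fromℤ-+ : ∀ a b → fromℤ (a + b) ≡ fromℤ a ℚ.+ fromℤ b
  fromℤ-+ a b = ℚ.toℚᵘ-injective (ℚᵘ.≃-trans (*≡* (eq a b)) (ℚᵘ.≃-sym (ℚ.toℚᵘ-homo-+ (fromℤ a) (fromℤ b))))
    where
    eq : ∀ a b → (a + b) * 1ℤ ≡ (a * 1ℤ + b * 1ℤ) * 1ℤ
    eq = solve-∀

  fromℤ-* : ∀ a b → fromℤ (a * b) ≡ fromℤ a ℚ.* fromℤ b
  fromℤ-* a b = ℚ.toℚᵘ-injective (ℚᵘ.≃-sym (ℚ.toℚᵘ-homo-* (fromℤ a) (fromℤ b)))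

  fromℤ-neg : ∀ a → fromℤ (- a) ≡ ℚ.- fromℤ a
  fromℤ-neg a = ℚ.toℚᵘ-injective (ℚᵘ.≃-sym (ℚ.toℚᵘ-homo‿- (fromℤ a)))

  fromℤ-fraction : ∀ q b n → q ℚ.* fromℤ b ≡ fromℤ n → ↥ q * b ≡ n * ↧ q
  fromℤ-fraction q@record{} b n eq = trans (sym (*-identityʳ (↥ q * b))) (trans
    (ℚᵘ.drop-*≡* (ℚᵘ.≃-trans (ℚᵘ.≃-sym (ℚ.toℚᵘ-homo-* q (fromℤ b))) (ℚᵘ.≃-reflexive (cong toℚᵘ eq))))
    (cong (n *_) (*-identityʳ (↧ q))))

  ↥-↧-coprime : ∀ q → Coprimality.Coprime ∣ ↥ q ∣ ∣ ↧ q ∣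
  ↥-↧-coprime (mkℚ _ _ coprime) = Coprimality.recompute coprime

  module RationalCongruence (p : ℕ) (p-prime : Prime p) where

    open PrimeModulus p p-prime

    -- If p divided `↧ q`, then ↥ q * b = n * ↧ q would make p divide `↥ q` as well, against lowest
    -- terms. So any representation n / b with b prime to p can stand in for the reduced one.
    ≋-fraction : ∀ {q b n m} → ¬ (+ p ∣ b) → q ℚ.* fromℤ b ≡ fromℤ n → n ≈ b * m → m ≋ q [mod p ]
    ≋-fraction {q} {b} {n} {m} p∤b qb≡n n≈bm = p∤↧q , [ ⊥-elim ∘ p∤b , id ]′
      (euclid b _ (∣-subst eq (∣n⇒∣m*n (↧ q) (divisible n≈bm))))
      where
      qb : ↥ q * b ≡ n * ↧ q
      qb = fromℤ-fraction q b n qb≡n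
      p∤↧q : ¬ (+ p ∣ ↧ q)
      p∤↧q p∣↧q = ℕ.<⇒≢ 1<p (sym (↥-↧-coprime q (∣⇒∣ᵤ p∣↥q , ∣⇒∣ᵤ p∣↧q)))
        where
        p∣↥q : + p ∣ ↥ q
        p∣↥q = [ id , ⊥-elim ∘ p∤b ]′ (euclid (↥ q) b (∣-subst (sym qb) (∣n⇒∣m*n n p∣↧q)))
      eq : ↧ q * (n - b * m) ≡ b * (↥ q - ↧ q * m)
      eq = trans (l (↧ q) n b m) (trans (cong (_- ↧ q * (b * m)) (sym qb)) (r (↧ q) (↥ q) b m))
        where
        l : ∀ d n b m → d * (n - b * m) ≡ n * d - d * (b * m)
        l = solve-∀
        r : ∀ d u b m → u * b - d * (b * m) ≡ b * (u - d * m)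
        r = solve-∀

    -- q · L ≡ m (mod p), without reference to the lowest terms of q.
    infix 4 _·_≈ℚ_
    record _·_≈ℚ_ (q : ℚ) (L m : ℤ) : Set where
      constructor fraction
      field
        {den num} : ℤ
        p∤den     : ¬ (+ p ∣ den)
        q*den≡num : q ℚ.* fromℤ den ≡ fromℤ num
        num*L≈    : num * L ≈ den * m

    module _ {L : ℤ} where

      1·≈ℚ : ∀ {m} → L ≈ m → 1ℚ · L ≈ℚ m
      1·≈ℚ L≈m = fraction {den = 1ℤ} {num = 1ℤ} (p∤small (s≤s z≤n) 1<p) refl (*-congˡ 1ℤ L≈m)

      0·≈ℚ : 0ℚ · L ≈ℚ 0ℤ
      0·≈ℚ = fraction {den = 1ℤ} {num = 0ℤ} (p∤small (s≤s z≤n) 1<p) refl (≡⇒≈ refl)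

      +-≈ℚ : ∀ {q r m n} → q · L ≈ℚ m → r · L ≈ℚ n → (q ℚ.+ r) · L ≈ℚ (m + n)
      +-≈ℚ {q} {r} {m} {n} (fraction {b} {a} p∤b qb≡a aL≈bm) (fraction {d} {c} p∤d rd≡c cL≈dn) =
        fraction {den = b * d} {num = a * d + c * b} ([ p∤b , p∤d ]′ ∘ euclid b d)
        (begin
          (q ℚ.+ r) ℚ.* fromℤ (b * d)
            ≡⟨ ℚ.*-distribʳ-+ (fromℤ (b * d)) q r ⟩
          q ℚ.* fromℤ (b * d) ℚ.+ r ℚ.* fromℤ (b * d)
            ≡⟨ cong₂ ℚ._+_ (extend {q} b d qb≡a) (trans (cong (λ t → r ℚ.* fromℤ t) (*-comm b d)) (extend {r} d b rd≡c)) ⟩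
          fromℤ (a * d) ℚ.+ fromℤ (c * b)
            ≡⟨ fromℤ-+ (a * d) (c * b) ⟨
          fromℤ (a * d + c * b) ∎)
        (≈-trans (≡⇒≈ (eq₁ a b c d L)) (≈-trans (+-cong (*-congˡ d aL≈bm) (*-congˡ b cL≈dn)) (≡⇒≈ (eq₂ b d m n))))
        where
        open ≡-Reasoning
        extend : ∀ {q a} b d → q ℚ.* fromℤ b ≡ fromℤ a → q ℚ.* fromℤ (b * d) ≡ fromℤ (a * d)
        extend {q} {a} b d eq = begin
          q ℚ.* fromℤ (b * d)           ≡⟨ cong (q ℚ.*_) (fromℤ-* b d) ⟩
          q ℚ.* (fromℤ b ℚ.* fromℤ d)   ≡⟨ ℚ.*-assoc q (fromℤ b) (fromℤ d) ⟨
          q ℚ.* fromℤ b ℚ.* fromℤ d     ≡⟨ cong (ℚ._* fromℤ d) eq ⟩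
          fromℤ a ℚ.* fromℤ d           ≡⟨ fromℤ-* a d ⟨
          fromℤ (a * d)                 ∎
        eq₁ : ∀ a b c d L → (a * d + c * b) * L ≡ d * (a * L) + b * (c * L)
        eq₁ = solve-∀
        eq₂ : ∀ b d m n → d * (b * m) + b * (d * n) ≡ b * d * (m + n)
        eq₂ = solve-∀

      *-≈ℚ : ∀ a {q m} → q · L ≈ℚ m → (fromℤ a ℚ.* q) · L ≈ℚ (a * m)
      *-≈ℚ a {q} {m} (fraction {b} {n} p∤b qb≡n nL≈bm) = fraction {den = b} {num = a * n} p∤b
        (trans (ℚ.*-assoc (fromℤ a) q (fromℤ b)) (trans (cong (fromℤ a ℚ.*_) qb≡n) (sym (fromℤ-* a n))))
        (≈-trans (≡⇒≈ (*-assoc a n L)) (≈-trans (*-congˡ a nL≈bm) (≡⇒≈ (eq a b m))))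
        where
        eq : ∀ a b m → a * (b * m) ≡ b * (a * m)
        eq = solve-∀

      ∑-≈ℚ : ∀ n (a s : ℕ → ℤ) (q : Fin n → ℚ) → (∀ i → q i · L ≈ℚ s (toℕ i)) →
        sumℚ {n} (λ i → fromℤ (a (toℕ i)) ℚ.* q i) · L ≈ℚ (∑ℤ[ i < n ] (a i * s i))
      ∑-≈ℚ zero    a s q q≈s = 0·≈ℚ
      ∑-≈ℚ (suc n) a s q q≈s = +-≈ℚ (*-≈ℚ (a 0) (q≈s Fin.zero)) (∑-≈ℚ n (a ∘ suc) (s ∘ suc) (q ∘ Fin.suc) (q≈s ∘ Fin.suc))

      /-≈ℚ : ∀ {r z q m n} → ¬ (+ p ∣ z) → r ℚ.* fromℤ z ≡ 1ℚ → q · L ≈ℚ m → z * n ≈ m → (r ℚ.* q) · L ≈ℚ n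
      /-≈ℚ {r} {z} {q} {m} {n} p∤z rz≡1 (fraction {b} {a} p∤b qb≡a aL≈bm) zn≈m =
        fraction {den = z * b} {num = a} ([ p∤z , p∤b ]′ ∘ euclid z b)
        (begin
          r ℚ.* q ℚ.* fromℤ (z * b)              ≡⟨ cong (r ℚ.* q ℚ.*_) (fromℤ-* z b) ⟩
          r ℚ.* q ℚ.* (fromℤ z ℚ.* fromℤ b)      ≡⟨ ℚ*.interchange r q (fromℤ z) (fromℤ b) ⟩
          (r ℚ.* fromℤ z) ℚ.* (q ℚ.* fromℤ b)    ≡⟨ cong₂ ℚ._*_ rz≡1 qb≡a ⟩
          1ℚ ℚ.* fromℤ a                         ≡⟨ ℚ.*-identityˡ (fromℤ a) ⟩
          fromℤ a                                ∎)
        (≈-trans aL≈bm (≈-trans (*-congˡ b (≈-sym zn≈m)) (≡⇒≈ (eq b z n))))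
        where
        open ≡-Reasoning
        eq : ∀ b z n → b * (z * n) ≡ z * b * n
        eq = solve-∀

      -- Both sequences obey the same linear recurrence modulo p, starting from 1 and from S 0 ≡ L,
      -- so the factor L is carried along. The claim covers the whole history because each new value
      -- depends on all earlier ones.
      history-≈ℚ : ∀ {r z} (S : ℕ → ℤ) → ¬ (+ p ∣ z) → r ℚ.* fromℤ z ≡ 1ℚ → L ≈ S 0 →
        (∀ w → z * S (suc w) ≈ ∑ℤ[ i < suc w ] (+ e (2 ℕ.* suc w ∸ 1) (suc i) * S (w ∸ i))) →
        ∀ v (i : Fin (suc v)) → lookup (history r v) i · L ≈ℚ S (v ∸ toℕ i)
      history-≈ℚ S p∤z rz≡1 S₀ S₊ zero    Fin.zero    = 1·≈ℚ S₀
      history-≈ℚ {r} S p∤z rz≡1 S₀ S₊ (suc v) Fin.zero    = /-≈ℚ {r = r} p∤z rz≡1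
        (∑-≈ℚ (suc v) (λ i → + e (2 ℕ.* suc v ∸ 1) (suc i)) (λ i → S (v ∸ i)) (lookup (history r v))
          (history-≈ℚ S p∤z rz≡1 S₀ S₊ v))
        (S₊ v)
      history-≈ℚ S p∤z rz≡1 S₀ S₊ (suc v) (Fin.suc i) = history-≈ℚ S p∤z rz≡1 S₀ S₊ v i

      ≈ℚ⇒≋ : ∀ {q m} → q · L ≈ℚ m → m ≋ q ℚ.* fromℤ L [mod p ]
      ≈ℚ⇒≋ {q} (fraction {b} {n} p∤b qb≡n nL≈bm) = ≋-fraction {q ℚ.* fromℤ L} p∤b
        (trans (ℚ*.xy∙z≈xz∙y q (fromℤ L) (fromℤ b)) (trans (cong (ℚ._* fromℤ L) qb≡n) (sym (fromℤ-* n L))))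
        nL≈bm

  -- From the moments to the sequences c and c̃

  even⊎odd : ∀ n → (∃[ m ] n ≡ m ℕ.+ m) ⊎ (∃[ m ] n ≡ suc (m ℕ.+ m))
  even⊎odd zero    = inj₁ (0 , refl)
  even⊎odd (suc n) = [ (λ (m , eq) → inj₂ (m , cong suc eq))
                     , (λ (m , eq) → inj₁ (suc m , cong suc (trans eq (sym (ℕ.+-suc m m))))) ]′ (even⊎odd n)

  ¬2∣⇒odd : ∀ {n} → ¬ (2 ℕ.∣ n) → ∃[ m ] n ≡ suc (m ℕ.+ m)
  ¬2∣⇒odd {n} ¬2∣n = [ (λ (m , eq) → contradiction (ℕ.divides m (trans eq (trans (sym (2*n≡n+n m)) (ℕ.*-comm 2 m)))) ¬2∣n) , id ]′
    (even⊎odd n)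

  -- Serves both congruences, since r enters only as the inverse of z: at z it is 1/z, which defines
  -- c; at -1 - z it is -1/(z + 1), which defines c̃, and the symbol's argument becomes z + 1.
  moment≋recSeq : ∀ {p} → Prime p → ¬ (2 ℕ.∣ p) → ∀ {r z} → r ℚ.* fromℤ z ≡ 1ℚ → ¬ (+ p ∣ z) →
    ∀ v → moment p z v ≋ recSeq r v ℚ.* fromℤ (legendre (- z) p) [mod p ]
  moment≋recSeq {p} p-prime 2∤p {r} {z} rz≡1 p∤z v = subst (λ q → moment p z v ≋ q ℚ.* fromℤ (legendre (- z) p) [mod p ])
    (lookup-history r v Fin.zero)
    (≈ℚ⇒≋ (history-≈ℚ (moment p z) p∤z rz≡1 (≈-sym (moment-0 z p∤-z)) (moment-suc z) v Fin.zero))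
    where
    open OddPrimeModulus p p-prime {proj₁ (¬2∣⇒odd 2∤p)} (proj₂ (¬2∣⇒odd 2∤p))
    open RationalCongruence p p-prime
    p∤-z : ¬ (+ p ∣ - z)
    p∤-z d = p∤z (∣-subst (neg-involutive z) (∣m⇒∣-m d))

  alternatingMoment : ∀ p z v →
    ∑ℤ[ k < p ] (-1ℤ ^ k * + ((2 ℕ.* k ℕ.+ 1) ℕ.^ (2 ℕ.* v)) * D k z) ≡ moment p (-1ℤ - z) v
  alternatingMoment p z v = ∑-cong p λ k → let w = + ((2 ℕ.* k ℕ.+ 1) ℕ.^ (2 ℕ.* v)) in
    trans (eq (-1ℤ ^ k) w (D k z)) (cong (w *_) (sym (D-reflect k z)))
    where
    eq : ∀ s w d → s * w * d ≡ w * (s * d)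
    eq = solve-∀

  moment≋c : ∀ p → Prime p → ¬ (2 ℕ.∣ p) → ∀ v z (z≢0 : z ≢ 0ℤ) → gcd (+ p) z ≡ 1ℤ →
    moment p z v ≋ c z z≢0 v ℚ.* fromℤ (legendre (- z) p) [mod p ]
  moment≋c p p-prime 2∤p v z z≢0 gcd≡1 = moment≋recSeq p-prime 2∤p
    (ℚ.*-inverseˡ (fromℤ z) {{≢-nonZero z≢0}}) (PrimeModulus.gcd≡1⇒p∤ p p-prime gcd≡1) v

  alternatingMoment≋c̃ : ∀ p → Prime p → ¬ (2 ℕ.∣ p) → ∀ v z (z≢-1 : z ≢ -1ℤ) → gcd (+ p) (z + 1ℤ) ≡ 1ℤ →
    ∑ℤ[ k < p ] (-1ℤ ^ k * + ((2 ℕ.* k ℕ.+ 1) ℕ.^ (2 ℕ.* v)) * D k z)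
      ≋ c̃ z z≢-1 v ℚ.* fromℤ (legendre (z + 1ℤ) p) [mod p ]
  alternatingMoment≋c̃ p p-prime 2∤p v z z≢-1 gcd≡1 =
    subst₂ (λ s u → s ≋ c̃ z z≢-1 v ℚ.* fromℤ (legendre u p) [mod p ])
      (sym (alternatingMoment p z v)) -z′≡z+1
      (moment≋recSeq p-prime 2∤p {z = z′} r*z′≡1
        (λ p∣z′ → PrimeModulus.gcd≡1⇒p∤ p p-prime gcd≡1 (subst (+ p ∣_) -z′≡z+1 (∣m⇒∣-m p∣z′))) v)
    where
    open ≡-Reasoning
    z′ = -1ℤ - z
    -z′≡z+1 : - z′ ≡ z + 1ℤ
    -z′≡z+1 = eq z
      where
      eq : ∀ z → - (-1ℤ - z) ≡ z + 1ℤ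
      eq = solve-∀
    instance _ = ≢-nonZero (z+1≢0 z≢-1)
    z+1⁻¹ = ℚ.1/ fromℤ (z + 1ℤ)
    r*z′≡1 : ℚ.- z+1⁻¹ ℚ.* fromℤ z′ ≡ 1ℚ
    r*z′≡1 = begin
      ℚ.- z+1⁻¹ ℚ.* fromℤ z′          ≡⟨ ℚ.neg-distribˡ-* z+1⁻¹ (fromℤ z′) ⟨
      ℚ.- (z+1⁻¹ ℚ.* fromℤ z′)        ≡⟨ ℚ.neg-distribʳ-* z+1⁻¹ (fromℤ z′) ⟩
      z+1⁻¹ ℚ.* ℚ.- fromℤ z′          ≡⟨ cong (z+1⁻¹ ℚ.*_) (trans (sym (fromℤ-neg z′)) (cong fromℤ -z′≡z+1)) ⟩
      z+1⁻¹ ℚ.* fromℤ (z + 1ℤ)        ≡⟨ ℚ.*-inverseˡ (fromℤ (z + 1ℤ)) ⟩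
      1ℚ                              ∎

open import Defs
open import Data.Integer.Base using (ℤ; +_; 0ℤ; 1ℤ; -1ℤ)
open import Data.Integer.GCD using (gcd)
open import Data.Nat.Base using (ℕ; _+_; _*_; _^_)
open import Data.Nat.Divisibility using (_∣_)
open import Data.Nat.Primality using (Prime)
open import Data.Product.Base using (_×_; _,_)
open import Relation.Binary.PropositionalEquality using (_≡_; _≢_)
open import Relation.Nullary using (¬_)
import Data.Integer.Base as ℤ
import Data.Rational.Base as ℚ

theorem1p2 : (p : ℕ) → Prime p → ¬ (2 ∣ p) →
    (v : ℕ) (z : ℤ) (z≢0 : z ≢ 0ℤ) (z≢-1 : z ≢ -1ℤ) →
    (gcd (+ p) z ≡ 1ℤ →
    ∑ℤ[ k < p ] (+ ((2 * k + 1) ^ (2 * v)) ℤ.* D k z)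
    ≋ c z z≢0 v ℚ.* fromℤ (legendre (ℤ.- z) p) [mod p ])
    ×
    (gcd (+ p) (z ℤ.+ 1ℤ) ≡ 1ℤ →
    ∑ℤ[ k < p ] (-1ℤ ℤ.^ k ℤ.* + ((2 * k + 1) ^ (2 * v)) ℤ.* D k z)
    ≋ c̃ z z≢-1 v ℚ.* fromℤ (legendre (z ℤ.+ 1ℤ) p) [mod p ])
theorem1p2 p p-prime 2∤p v z z≢0 z≢-1 =
  DelannoyMoments.moment≋c p p-prime 2∤p v z z≢0 ,
  DelannoyMoments.alternatingMoment≋c̃ p p-prime 2∤p v z z≢-1
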